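{- Let $m\in\mathbb{N}$ and let $p$ be a minimal idempotent in $(\beta\mathbb{N},+)$. Then for every $A\in\bigotimes_{i=1}^m p$ and every $T\in\mathcal{P}_f(\mathbb{P})$ there exist functions $\alpha:\mathcal{P}_f(\mathbb{N}^{\mathbb{N}})\to\mathbb{N}$ and $H:\mathcal{P}_f(\mathbb{N}^{\mathbb{N}})\to\mathcal{P}_f(\mathbb{N})$ such that (1) if $G,K\in\mathcal{P}_f(\mathbb{N}^{\mathbb{N}})$ and $G\subsetneq K$, then $H(G)<H(K)$; and (2) if $n\in\mathbb{N}$ with $n\ge m$, and $G_1\subsetneq G_2\subsetneq\cdots\subsetneq G_n$ in $\mathcal{P}_f(\mathbb{N}^{\mathbb{N}})$, then for all $\beta_1<\beta_2<\cdots<\beta_m$ in $\mathcal{P}_f(\mathbb{N})$ with $\max\beta_m\le n$, all $f_i\in G_i$ ($i\in\{1,\ldots,n\}$), and all $P_1,\ldots,P_m\in T$, $$\left(\sum_{i\in\beta_1}\alpha(G_i)+P_1\Bigl(\sum_{i\in\beta_1}\sum_{t\in H(G_i)}f_i(t)\Bigr),\ldots,\sum_{i\in\beta_m}\alpha(G_i)+P_m\Bigl(\sum_{i\in\beta_m}\sum_{t\in H(G_i)}f_i(t)\Bigr)\right)\in A.$$ In fact, the same holds for every idempotent $p$ of $(\mathcal{J}_p,+)$ (in place of a minimal idempotent).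
   Context: $\mathbb{N}$ is the set of positive integers; $\mathcal{P}_f(X)$ is the set of nonempty finite subsets of $X$; $\mathbb{N}^{\mathbb{N}}$ is the set of all functions $\mathbb{N}\to\mathbb{N}$. For $\beta,\gamma\in\mathcal{P}_f(\mathbb{N})$, $\beta<\gamma$ means $\max\beta<\min\gamma$. $\mathbb{P}$ is the set of one-variable polynomials with integer coefficients and zero constant term. $\beta\mathbb{N}$ is the set of ultrafilters on $\mathbb{N}$, with the Stone topology and the operation: $A\in p+q$ iff $\{x\in\mathbb{N}:-x+A\in q\}\in p$, where $-x+A=\{y\in\mathbb{N}:x+y\in A\}$. An ultrafilter $p$ is idempotent if $p+p=p$; a minimal idempotent is an idempotent lying in $K(\beta\mathbb{N},+)$, the smallest two-sided ideal (the union of all minimal left ideals) of $(\beta\mathbb{N},+)$. A set $A\subseteq\mathbb{N}$ is a $J_p$-set if for every $F\in\mathcal{P}_f(\mathbb{P})$ and every $H\in\mathcal{P}_f(\mathbb{N}^{\mathbb{N}})$ there exist $a\in\mathbb{N}$ and $\beta\in\mathcal{P}_f(\mathbb{N})$ such that $a+P(\sum_{t\in\beta}f(t))\in A$ for all $P\in F$ and $f\in H$. $\mathcal{J}_p=\{q\in\beta\mathbb{N}:\text{every }A\in q\text{ is a }J_p\text{ -set}\}$ (the subscript $p$ stands for "polynomial" and is not an ultrafilter); it is a two-sided ideal of $(\beta\mathbb{N},+)$. Tensor products: for ultrafilters $p_1,\ldots,p_k$ on $\mathbb{N}$, $\bigotimes_{i=1}^k p_i$ is the ultrafilter on $\mathbb{N}^k$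 defined recursively by $\bigotimes_{i=1}^1p_i=p_1$, and, for $A\subseteq\mathbb{N}^{k+1}$, $A\in\bigotimes_{i=1}^{k+1}p_i$ iff $\{(x_1,\ldots,x_k)\in\mathbb{N}^k:\{x_{k+1}\in\mathbb{N}:(x_1,\ldots,x_{k+1})\in A\}\in p_{k+1}\}\in\bigotimes_{i=1}^kp_i$. $\bigotimes_{i=1}^mp$ is the case $p_i=p$ for all $i$. -}

module Defs where

open import Level using (0ℓ) renaming (suc to lsuc)
open import Data.Fin using (Fin; inject₁; fromℕ)
import Data.Fin as Fin
open import Data.Integer as ℤ using (ℤ; +_; 0ℤ)
open import Data.List using (List; []; _∷_; sum; map)
open import Data.List.NonEmpty as List⁺ using (List⁺; toList; foldr₁)
import Data.List.Membership.Setoid as Membership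
import Data.List.Relation.Unary.Unique.Setoid as Uniqueness
open import Data.Nat
  using (ℕ; zero; suc; NonZero; >-nonZero; >-nonZero⁻¹; _+_; _⊔_; _⊓_; _<_)
open import Data.Nat.Properties using (≤-trans; m≤m+n)
open import Data.Product using (Σ-syntax; ∃-syntax; _×_; _,_; uncurry)
open import Data.Sum using (_⊎_; inj₁; inj₂)
open import Data.Vec as Vec using (Vec; _∷ʳ_)
open import Function using (_∘_; id; _⇔_)
open import Relation.Binary using (Setoid; _Respects_)
open import Relation.Binary.PropositionalEquality
  using (_≡_; refl; sym; trans; setoid; _→-setoid_)
open import Relation.Nullary using (¬_; contradiction)
open import Relation.Unary using (Pred; ∁; Satisfiable; _∩_)
import Relation.Unary as U

-- The paper's ℕ.  The proof field is irrelevant, so that equality of positive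
-- integers is equality of their values.
record ℕ⁺ : Set where
  constructor pos
  field
    value       : ℕ
    .{{nonZero}} : NonZero value

open ℕ⁺ public using (value)

infixl 6 _+⁺_

_+⁺_ : ℕ⁺ → ℕ⁺ → ℕ⁺
pos m +⁺ pos n = pos (m + n) {{>-nonZero (≤-trans (>-nonZero⁻¹ m) (m≤m+n m n))}}

toℤ : ℕ⁺ → ℤ
toℤ x = + value x

-- Nonempty finite subsets of a setoid, listed without repetition (so that a
-- sum over the list is the sum over the set).  The order of the list is
-- discarded by the equality of 𝒫f below.
record FinSet (S : Setoid 0ℓ 0ℓ) : Set where
  field
    elements : List⁺ (Setoid.Carrier S)
    unique   : Uniqueness.Unique S (toList elements)

open FinSet public using (elements)

module _ {S : Setoid 0ℓ 0ℓ} where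

  infix 4 _∈_ _⊆_ _⊊_

  _∈_ : Setoid.Carrier S → FinSet S → Set
  x ∈ G = Membership._∈_ S x (toList (elements G))

  _⊆_ : FinSet S → FinSet S → Set
  G ⊆ K = ∀ {x} → x ∈ G → x ∈ K

  _⊊_ : FinSet S → FinSet S → Set
  G ⊊ K = (G ⊆ K) × ¬ (K ⊆ G)

𝒫f : Setoid 0ℓ 0ℓ → Setoid 0ℓ 0ℓ
𝒫f S = record
  { Carrier       = FinSet S
  ; _≈_           = λ G K → (G ⊆ K) × (K ⊆ G)
  ; isEquivalence = record
    { refl  = id , id
    ; sym   = λ (p , q) → q , p
    ; trans = λ (p , q) (r , s) → (λ x∈ → r (p x∈)) , (λ x∈ → q (s x∈))
    }
  }

Pos : Setoid 0ℓ 0ℓ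
Pos = setoid ℕ⁺

-- ℕ^ℕ, with pointwise equality.
Seq : Setoid 0ℓ 0ℓ
Seq = ℕ⁺ →-setoid ℕ⁺

max min : FinSet Pos → ℕ
max β = foldr₁ _⊔_ (List⁺.map value (elements β))
min β = foldr₁ _⊓_ (List⁺.map value (elements β))

infix 4 _≺_

_≺_ : FinSet Pos → FinSet Pos → Set
β ≺ γ = max β < min γ

∑ : FinSet Pos → (ℕ⁺ → ℕ) → ℕ
∑ β f = sum (map f (toList (elements β)))

-- The list c₁ ∷ c₂ ∷ … ∷ c_d ∷ [] stands for c₁x + c₂x² + … + c_d x^d.
Poly₀ : Set
Poly₀ = List ℤ

-- coeff P i is the coefficient of x^(i+1).
coeff : Poly₀ → ℕ → ℤ
coeff []       _       = 0ℤ
coeff (c ∷ cs) zero    = c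
coeff (c ∷ cs) (suc i) = coeff cs i

eval : Poly₀ → ℤ → ℤ
eval []       x = 0ℤ
eval (c ∷ cs) x = x ℤ.* (c ℤ.+ eval cs x)

-- Equality is coefficientwise, hence insensitive to trailing zeros.
ℙ : Setoid 0ℓ 0ℓ
ℙ = record
  { Carrier       = Poly₀
  ; _≈_           = λ P Q → ∀ i → coeff P i ≡ coeff Q i
  ; isEquivalence = record
    { refl  = λ _ → refl
    ; sym   = λ e i → sym (e i)
    ; trans = λ e e′ i → trans (e i) (e′ i)
    }
  }

-- An integer, or a vector of integers, lies in a set of (vectors of) positive
-- integers: in particular all the integers involved are positive.
infix 4 _∈ℤ_ _∈ℤⁿ_

_∈ℤ_ : ℤ → Pred ℕ⁺ 0ℓ → Set
z ∈ℤ A = ∃[ x ] toℤ x ≡ z × A x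

_∈ℤⁿ_ : ∀ {k} → Vec ℤ k → Pred (Vec ℕ⁺ k) 0ℓ → Set
zs ∈ℤⁿ A = ∃[ xs ] Vec.map toℤ xs ≡ zs × A xs

-- "∅ is not a member" is expressed as "every member is inhabited".  Read
-- constructively these axioms are strong: applied to constant predicates,
-- `inhabited` and `ultra` decide every P : Set, so an ultrafilter brings its
-- own excluded middle with it and no such hypothesis has to be added.
-- That X itself is a member follows from `ultra` and `inhabited`.
record Ultrafilter (X : Set) : Set₁ where
  field
    member    : Pred (Pred X 0ℓ) 0ℓ
    inhabited : ∀ {A} → member A → Satisfiable A
    upward    : ∀ {A B} → A U.⊆ B → member A → member B
    meet      : ∀ {A B} → member A → member B → member (A ∩ B)
    ultra     : ∀ A → member A ⊎ member (∁ A)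

open Ultrafilter

infix 4 _∈ᵤ_ _≈ᵤ_

_∈ᵤ_ : ∀ {X} → Pred X 0ℓ → Ultrafilter X → Set
A ∈ᵤ p = member p A

_≈ᵤ_ : ∀ {X} → Ultrafilter X → Ultrafilter X → Set₁
p ≈ᵤ q = ∀ A → A ∈ᵤ p ⇔ A ∈ᵤ q

image : ∀ {X Y} → (X → Y) → Ultrafilter X → Ultrafilter Y
image f p = record
  { member    = λ A → (A ∘ f) ∈ᵤ p
  ; inhabited = λ A∈ → let (x , Afx) = inhabited p A∈ in f x , Afx
  ; upward    = λ A⊆B → upward p A⊆B
  ; meet      = meet p
  ; ultra     = λ A → ultra p (A ∘ f)
  }

infixl 7 _⊗_

_⊗_ : ∀ {X Y} → Ultrafilter X → Ultrafilter Y → Ultrafilter (X × Y)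
p ⊗ q = record
  { member    = λ A → (λ x → (λ y → A (x , y)) ∈ᵤ q) ∈ᵤ p
  ; inhabited = λ A∈ →
      let (x , Ax∈) = inhabited p A∈
          (y , Axy) = inhabited q Ax∈
      in (x , y) , Axy
  ; upward    = λ A⊆B → upward p (upward q A⊆B)
  ; meet      = λ A∈ B∈ → upward p (uncurry (meet q)) (meet p A∈ B∈)
  ; ultra     = λ A → split A (ultra p (λ x → (λ y → A (x , y)) ∈ᵤ q))
  }
  where
  split : ∀ A →
    (λ x → (λ y → A (x , y)) ∈ᵤ q) ∈ᵤ p ⊎ ∁ (λ x → (λ y → A (x , y)) ∈ᵤ q) ∈ᵤ p →
    (λ x → (λ y → A (x , y)) ∈ᵤ q) ∈ᵤ p ⊎ (λ x → (λ y → ¬ A (x , y)) ∈ᵤ q) ∈ᵤ p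
  split A (inj₁ A∈) = inj₁ A∈
  split A (inj₂ A∉) = inj₂ (upward p (λ {x} → complement x) A∉)
    where
    complement : ∀ x → ¬ ((λ y → A (x , y)) ∈ᵤ q) → (λ y → ¬ A (x , y)) ∈ᵤ q
    complement x Ax∉ with ultra q (λ y → A (x , y))
    ... | inj₁ Ax∈  = contradiction Ax∈ Ax∉
    ... | inj₂ ∁Ax∈ = ∁Ax∈

-- p₁ ⊗ ⋯ ⊗ p_{k+1}, as an ultrafilter on ℕ^(k+1).
⨂ : ∀ k → (Fin (suc k) → Ultrafilter ℕ⁺) → Ultrafilter (Vec ℕ⁺ (suc k))
⨂ zero    p = image Vec.[_] (p Fin.zero)
⨂ (suc k) p = image (uncurry _∷ʳ_) (⨂ k (p ∘ inject₁) ⊗ p (fromℕ (suc k)))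

βℕ : Set₁
βℕ = Ultrafilter ℕ⁺

-- Membership of A in p ⊕ q unfolds to {x : {y : x + y ∈ A} ∈ q} ∈ p.
infixl 6 _⊕_

_⊕_ : βℕ → βℕ → βℕ
p ⊕ q = image (uncurry _+⁺_) (p ⊗ q)

Idempotent : βℕ → Set₁
Idempotent p = p ⊕ p ≈ᵤ p

record IsLeftIdeal (L : Pred βℕ (lsuc 0ℓ)) : Set₁ where
  field
    respects : L Respects _≈ᵤ_
    nonempty : Satisfiable L
    absorbs  : ∀ q {p} → L p → L (q ⊕ p)

IsMinimalLeftIdeal : Pred βℕ (lsuc 0ℓ) → Set₂
IsMinimalLeftIdeal L =
  IsLeftIdeal L × (∀ L′ → IsLeftIdeal L′ → L′ U.⊆ L → L U.⊆ L′)

-- K(βℕ,+), as the union of all minimal left ideals.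
K : Pred βℕ (lsuc (lsuc 0ℓ))
K p = ∃[ L ] IsMinimalLeftIdeal L × L p

MinimalIdempotent : βℕ → Set₂
MinimalIdempotent p = Idempotent p × K p

IsJₚ-set : Pred ℕ⁺ 0ℓ → Set
IsJₚ-set A =
  (F : FinSet ℙ) (H : FinSet Seq) →
  Σ[ a ∈ ℕ⁺ ] Σ[ β ∈ FinSet Pos ]
    (∀ P f → P ∈ F → f ∈ H →
      toℤ a ℤ.+ eval P (+ ∑ β (λ t → value (f t))) ∈ℤ A)

𝒥ₚ : Pred βℕ (lsuc 0ℓ)
𝒥ₚ q = ∀ A → A ∈ᵤ q → IsJₚ-set A

{-# OPTIONS --safe #-}
module Submission where

-- A minimal idempotent p lies in 𝒥ₚ by colour focusing.  Call an integer x a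
-- point of E if n + x ∈ E for p-many n.  Minimality makes every nonempty set of
-- points syndetic, so finitely many translates of it serve as colours, and the
-- polynomial recurrence theorem follows by induction on the weight vector of a
-- family of polynomial maps (PET induction).
--
-- For an idempotent p in 𝒥ₚ, the values α(G) and H(G) are chosen by recursion
-- on G.  Only finitely many partial tuples arise from chains below G, and for
-- each of them the set of admissible continuations belongs to p; the
-- intersection of these sets is a Jₚ-set, which provides α(G) and H(G).

open import Defs
open import Level using (0ℓ) renaming (suc to lsuc)
open import Data.Empty using (⊥; ⊥-elim)
open import Data.Fin as Fin using (Fin; fromℕ)
import Data.Fin.Properties as Fin
open import Data.Integer as ℤ using (ℤ; +_; 0ℤ)
import Data.Integer.Properties as ℤ
open import Data.Integer.Tactic.RingSolver using (solve-∀)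
open import Data.List
  using (List; []; _∷_; _++_; _∷ʳ_; length; map; concatMap; filter; deduplicate; upTo)
open import Data.List.Membership.Propositional using (find; lose) renaming (_∈_ to _∈ₗ_)
import Data.List.Membership.Propositional.Properties as ∈ₗ
import Data.List.Membership.Setoid as Membership
import Data.List.Membership.Setoid.Properties as ∈ₛ
open import Data.List.NonEmpty as List⁺ using (_∷_; toList; foldr₁)
import Data.List.Properties as List
open import Data.List.Relation.Binary.Permutation.Propositional using (_↭_; ↭-sym; ↭⇒↭ₛ)
import Data.List.Relation.Binary.Permutation.Propositional.Properties as ↭
import Data.List.Relation.Binary.Permutation.Setoid.Properties as ↭ₛ
open import Data.List.Relation.Unary.All as All using (All; []; _∷_)
import Data.List.Relation.Unary.All.Properties as All
open import Data.List.Relation.Unary.AllPairs as AllPairs using (AllPairs; []; _∷_)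
open import Data.List.Relation.Unary.Any as Any using (Any; here; there)
import Data.List.Relation.Unary.Any.Properties as Any
import Data.List.Relation.Unary.Linked.Properties as Linked
import Data.List.Relation.Unary.Unique.DecSetoid.Properties as UniqueDec
import Data.List.Relation.Unary.Unique.Setoid as UniqueSetoid
import Data.List.Relation.Unary.Unique.Setoid.Properties as Unique
import Data.List.Sort as Sort
open import Data.Maybe using (Maybe; just; nothing)
open import Data.Nat as ℕ using (ℕ; zero; suc; z≤n; s≤s; _≤_; _<_; _⊔_; _⊓_; >-nonZero; >-nonZero⁻¹)
open import Data.Nat.Induction using (<-wellFounded)
open import Data.Nat.ListAction using (sum)
open import Data.Nat.ListAction.Properties using (sum-++; sum-↭)
import Data.Nat.Properties as ℕ
open import Data.Product using (Σ-syntax; _×_; _,_; proj₁; proj₂)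
open import Data.Sum using (_⊎_; inj₁; inj₂; [_,_]′; map₂)
open import Data.Unit using (⊤; tt)
open import Data.Vec as Vec using (Vec; []; _∷_; tabulate)
open import Data.Vec.Functional using (last)
import Data.Vec.Properties as Vec
open import Data.Vec.Relation.Binary.Lex.Strict as Lex using (Lex-<; this; next)
open import Function using (_∘_; id; Equivalence; _⇔_; mk⇔; Func; _⟨$⟩_)
open import Induction.WellFounded as WF
  using (WellFounded; Acc; acc; WfRec; module FixPoint; module Subrelation)
open import Relation.Binary using (Setoid; DecSetoid; tri<; tri≈; tri>)
import Relation.Binary.Construct.On as On
open import Relation.Binary.PropositionalEquality
  using (_≡_; refl; sym; trans; cong; cong₂; subst; subst₂; module ≡-Reasoning)
open import Relation.Nullary using (¬_; ¬?; Dec; yes; no; contradiction)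
open import Relation.Unary using (Pred)

open Equivalence using (to; from)
open Ultrafilter

-- Polynomial maps and their weights

-- The recurrence theorem is proved over the integers, because polynomials take negative values and
-- base points are moved by them. The return to positive integers is possible since an idempotent
-- contains every cofinite set. The variable of the theorem is a functional `u` sending each
-- sequence to its sum over one index set: all sequences of a finite family have to be served by the
-- same set, and adding functionals amounts to uniting disjoint index sets. In the construction of
-- `α` and `H`, neither the chain nor the blocks are known when the values at G are chosen. Every
-- partial tuple must therefore admit both an increase of its current coordinate and the passage to
-- the next one, for each polynomial in `T` and each sequence in G. A second obstacle is
-- extensionality: equal finite sets may be listed differently, so the recursion needs a choice that
-- depends only on the extension of a predicate. Least witnesses provide it on codes built from
-- natural numbers.

split : ∀ {a b c} {X : Set a} {A : Pred X b} {B : Pred X c} {xs} → All (λ x → A x ⊎ B x) xs →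
        Σ[ ys ∈ List X ] All A ys × All (λ x → x ∈ₗ ys ⊎ B x) xs
split []              = [] , [] , []
split (inj₁ a ∷ sums) =
  let (ys , as , rest) = split sums
  in _ ∷ ys , a ∷ as ,
     inj₁ (here refl) ∷ All.map (λ { (inj₁ i) → inj₁ (there i) ; (inj₂ b) → inj₂ b }) rest
split (inj₂ b ∷ sums) = let (ys , as , rest) = split sums in ys , as , inj₂ b ∷ rest

module PolynomialMaps {M : Set} (_⊞_ : M → M → M) where

  Map : Set
  Map = M → ℤ

  infixl 6 _⊖_

  _⊖_ : Map → Map → Map
  (φ ⊖ ψ) u = φ u ℤ.- ψ u

  -- Besides `φ u`, the value `φ h` is subtracted, which keeps the difference free of a constant
  -- term.
  Δ : M → Map → Map
  Δ h φ u = φ (u ⊞ h) ℤ.- φ h ℤ.- φ u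

  -- Polynomial maps of degree at most d without constant term.
  data Deg : ℕ → Map → Set where
    vanish : ∀ {φ} → (∀ u → φ u ≡ 0ℤ) → Deg 0 φ
    differ : ∀ {d φ} → (∀ h → Deg d (Δ h φ)) → Deg (suc d) φ

  Deg-resp : ∀ d {φ ψ} → (∀ u → φ u ≡ ψ u) → Deg d φ → Deg d ψ
  Deg-resp zero    e (vanish D) = vanish λ u → trans (sym (e u)) (D u)
  Deg-resp (suc d) e (differ D) = differ λ h →
    Deg-resp d (λ u → cong₂ ℤ._-_ (cong₂ ℤ._-_ (e (u ⊞ h)) (e h)) (e u)) (D h)

  Deg-+ : ∀ d {φ ψ} → Deg d φ → Deg d ψ → Deg d (λ u → φ u ℤ.+ ψ u)
  Deg-+ zero            (vanish D) (vanish D′) = vanish λ u → cong₂ ℤ._+_ (D u) (D′ u)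
  Deg-+ (suc d) {φ} {ψ} (differ D) (differ D′) = differ λ h →
    Deg-resp d (λ u → Δ-+ (φ (u ⊞ h)) (φ h) (φ u) (ψ (u ⊞ h)) (ψ h) (ψ u))
      (Deg-+ d (D h) (D′ h))
    where
    Δ-+ : ∀ a b c a′ b′ c′ → (a ℤ.- b ℤ.- c) ℤ.+ (a′ ℤ.- b′ ℤ.- c′) ≡
                             (a ℤ.+ a′) ℤ.- (b ℤ.+ b′) ℤ.- (c ℤ.+ c′)
    Δ-+ = solve-∀

  Deg-scale : ∀ d k {φ} → Deg d φ → Deg d (λ u → k ℤ.* φ u)
  Deg-scale zero    k     (vanish D) = vanish λ u → trans (cong (k ℤ.*_) (D u)) (ℤ.*-zeroʳ k)
  Deg-scale (suc d) k {φ} (differ D) = differ λ h →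
    Deg-resp d (λ u → Δ-* k (φ (u ⊞ h)) (φ h) (φ u)) (Deg-scale d k (D h))
    where
    Δ-* : ∀ k a b c → k ℤ.* (a ℤ.- b ℤ.- c) ≡ k ℤ.* a ℤ.- k ℤ.* b ℤ.- k ℤ.* c
    Δ-* = solve-∀

  Deg-⊖ : ∀ d {φ ψ} → Deg d φ → Deg d ψ → Deg d (φ ⊖ ψ)
  Deg-⊖ d {φ} {ψ} D D′ =
    Deg-resp d (λ u → sub (φ u) (ψ u)) (Deg-+ d D (Deg-scale d ℤ.-1ℤ D′))
    where
    sub : ∀ a b → a ℤ.+ ℤ.-1ℤ ℤ.* b ≡ a ℤ.- b
    sub = solve-∀

  Deg-suc : ∀ d {φ} → Deg d φ → Deg (suc d) φ
  Deg-suc zero    (vanish D) = differ λ h → vanish λ u →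
    cong₂ ℤ._-_ (cong₂ ℤ._-_ (D (u ⊞ h)) (D h)) (D u)
  Deg-suc (suc d) (differ D) = differ λ h → Deg-suc d (D h)

  Deg-mono : ∀ {d e φ} → d ≤ e → Deg d φ → Deg e φ
  Deg-mono d≤e = go (ℕ.≤⇒≤′ d≤e)
    where
    go : ∀ {d e φ} → d ℕ.≤′ e → Deg d φ → Deg e φ
    go (ℕ.≤′-reflexive refl) D = D
    go (ℕ.≤′-step le)        D = Deg-suc _ (go le D)

  module _ (L : Map) (L-⊞ : ∀ u v → L (u ⊞ v) ≡ L u ℤ.+ L v) where

    Deg-additive : Deg 1 L
    Deg-additive = differ λ h → vanish λ u →
      trans (cong (λ k → k ℤ.- L h ℤ.- L u) (L-⊞ u h)) (cancel (L u) (L h))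
      where
      cancel : ∀ a b → a ℤ.+ b ℤ.- b ℤ.- a ≡ 0ℤ
      cancel = solve-∀

    -- By the Leibniz rule, `Δ h` of the product is a sum of constant multiples of `L`, `φ` and
    -- `Δ h φ`, and of the product of `L` with `Δ h φ`, to which induction on `d` applies.
    Deg-additive-* : ∀ d {φ} → Deg d φ → Deg (suc d) (λ u → L u ℤ.* φ u)
    Deg-additive-* zero (vanish D) =
      Deg-mono z≤n (vanish λ u → trans (cong (L u ℤ.*_) (D u)) (ℤ.*-zeroʳ (L u)))
    Deg-additive-* (suc d) {φ} (differ D) = differ λ h →
      Deg-resp (suc d)
        (λ u → trans (leibniz (L u) (L h) (φ (u ⊞ h)) (φ h) (φ u))
                     (cong (λ k → k ℤ.* φ (u ⊞ h) ℤ.- L h ℤ.* φ h ℤ.- L u ℤ.* φ u)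
                           (sym (L-⊞ u h))))
        (Deg-+ (suc d)
          (Deg-+ (suc d) (Deg-scale (suc d) (φ h) (Deg-mono (s≤s z≤n) Deg-additive))
                         (Deg-scale (suc d) (L h) (differ D)))
          (Deg-+ (suc d) (Deg-additive-* d (D h))
                         (Deg-suc d (Deg-scale d (L h) (D h)))))
      where
      leibniz : ∀ l k a b c →
        (b ℤ.* l ℤ.+ k ℤ.* c) ℤ.+ (l ℤ.* (a ℤ.- b ℤ.- c) ℤ.+ k ℤ.* (a ℤ.- b ℤ.- c)) ≡
        (l ℤ.+ k) ℤ.* a ℤ.- k ℤ.* b ℤ.- l ℤ.* c
      leibniz = solve-∀

    Deg-eval : ∀ P → Deg (length P) (λ u → eval P (L u))
    Deg-eval []       = vanish λ u → refl
    Deg-eval (c ∷ cs) =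
      Deg-resp (suc (length cs)) (λ u → expand (L u) c (eval cs (L u)))
        (Deg-+ (suc (length cs))
          (Deg-scale (suc (length cs)) c (Deg-mono (s≤s z≤n) Deg-additive))
          (Deg-additive-* (length cs) (Deg-eval cs)))
      where
      expand : ∀ l c e → c ℤ.* l ℤ.+ l ℤ.* e ≡ l ℤ.* (c ℤ.+ e)
      expand = solve-∀

  -- A family of maps is sorted into classes modulo lower degree: the level of
  -- degree d of a system lists representatives of the classes of degree d,
  -- the highest degree coming first.
  System : ℕ → Set
  System = Vec (List Map)

  WellDegreed : ∀ {d} → System d → Set
  WellDegreed {zero}  []       = ⊤
  WellDegreed {suc d} (gs ∷ s) = All (Deg (suc d)) gs × WellDegreed s

  Covers : ∀ {d} → System d → Map → Set
  Covers {zero}  []       φ = ⊥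
  Covers {suc d} (gs ∷ s) φ = Any (λ g → Deg d (φ ⊖ g)) gs ⊎ Covers s φ

  -- Zero maps recur trivially and need no class; subtracting a representative from itself produces
  -- them.
  Covers₀ : ∀ {d} → System d → Map → Set
  Covers₀ s φ = Covers s φ ⊎ Deg 0 φ

  weight : ∀ {d} → System d → Vec ℕ d
  weight = Vec.map length

  infix 4 _⊏_

  -- Since the highest degree is compared first, one class lost there pays for any number of new
  -- classes in lower degrees.
  _⊏_ : ∀ {d} → Vec ℕ d → Vec ℕ d → Set
  _⊏_ = Lex-< _≡_ ℕ._<_

  ⊏-wellFounded : ∀ {d} → WellFounded (_⊏_ {d})
  ⊏-wellFounded = Lex.<-wellFounded trans (λ { refl lt → lt }) <-wellFounded

  Covers⇒Deg : ∀ {d} (s : System d) → WellDegreed s → ∀ {φ} → Covers s φ → Deg d φ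
  Covers⇒Deg {suc d} (gs ∷ s) (Dgs , _) {φ} (inj₁ c) = go Dgs c
    where
    restore : ∀ a b → b ℤ.+ (a ℤ.- b) ≡ a
    restore = solve-∀
    go : ∀ {gs} → All (Deg (suc d)) gs → Any (λ g → Deg d (φ ⊖ g)) gs → Deg (suc d) φ
    go {g ∷ _} (Dg ∷ _)  (here D)  =
      Deg-resp (suc d) (λ u → restore (φ u) (g u)) (Deg-+ (suc d) Dg (Deg-suc d D))
    go         (_ ∷ Dgs) (there c) = go Dgs c
  Covers⇒Deg {suc d} (gs ∷ s) (_ , W) (inj₂ c) = Deg-suc d (Covers⇒Deg s W c)

  -- In positive degree every map represents its own class: the induction may start from any weight.
  top : ∀ d → List Map → System d
  top zero    φs = []
  top (suc d) φs = φs ∷ Vec.replicate d []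

  top-wellDegreed : ∀ d {φs} → All (Deg d) φs → WellDegreed (top d φs)
  top-wellDegreed zero    Ds = tt
  top-wellDegreed (suc d) Ds = Ds , empty d
    where
    empty : ∀ d → WellDegreed (Vec.replicate d [])
    empty zero    = tt
    empty (suc d) = [] , empty d

  top-covers : ∀ d {φs} → All (Deg d) φs → All (Covers₀ (top d φs)) φs
  top-covers zero    Ds = All.map inj₂ Ds
  top-covers (suc d) Ds = All.tabulate λ {φ} φ∈ →
    inj₁ (inj₁ (Any.map (λ { refl → Deg-mono z≤n (vanish λ u → ℤ.+-inverseʳ (φ u)) }) φ∈))

  -- `nothing` plays the role of a shift by the empty index set. In colour focusing it accounts for
  -- the newest round, and `just γ` for an earlier one.
  shift : Maybe M → Map → Map
  shift nothing  φ   = φ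
  shift (just h) φ u = φ (u ⊞ h) ℤ.- φ h

  Deg-shift : ∀ {d φ} h → Deg (suc d) φ → Deg d (shift h φ ⊖ φ)
  Deg-shift {φ = φ} nothing D = Deg-mono z≤n (vanish λ u → ℤ.+-inverseʳ (φ u))
  Deg-shift (just h) (differ D) = D h

  Deg-shift-⊖ : ∀ {d φ g g₀} h → Deg (suc d) φ → Deg d (φ ⊖ g) →
                Deg d (shift h φ ⊖ g₀ ⊖ (g ⊖ g₀))
  Deg-shift-⊖ {d} {φ} {g} {g₀} h D D′ =
    Deg-resp d (λ u → rearrange (φ u) (g u) (shift h φ u) (g₀ u)) (Deg-+ d D′ (Deg-shift h D))
    where
    rearrange : ∀ a b c e → a ℤ.- b ℤ.+ (c ℤ.- a) ≡ c ℤ.- e ℤ.- (b ℤ.- e)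
    rearrange = solve-∀

  -- `g` is fixed before the shifts: colour focusing subtracts the same `g` in every round while `Γ`
  -- grows, and only `s′` varies.
  Reducible : ∀ {d} → System d → Set
  Reducible {d} s =
    Σ[ g ∈ Map ] Deg d g ×
    (∀ Φ → All (Covers s) Φ → (Γ : List (Maybe M)) →
     Σ[ s′ ∈ System d ] WellDegreed s′ × weight s′ ⊏ weight s ×
     All (λ φ → All (λ h → Covers₀ s′ (shift h φ ⊖ g)) Γ) Φ)

  -- Subtracting a representative g of lowest degree from all shifts of a family
  -- removes the class of g, preserves the number of the other classes of at
  -- least that degree, and creates new classes only in lower degree.
  reduce : ∀ {d} (s : System d) → WellDegreed s → (∀ φ → ¬ Covers s φ) ⊎ Reducible s
  reduce {zero}  []       _         = inj₁ (λ _ ())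
  -- Lower degrees are searched first, because subtracting a `g` of higher degree would lift the
  -- lower maps into a new class in the degree of `g`.
  reduce {suc d} (gs ∷ s) (Dgs , W) with reduce s W
  ... | inj₂ (g , Dg , red) = inj₂ (g , Deg-suc d Dg , red′)
    where
    red′ : ∀ Φ → All (Covers (gs ∷ s)) Φ → ∀ Γ → _
    red′ Φ cov Γ =
      let (Φₗ , covₗ , sort) = split (All.map (λ { (inj₁ c) → inj₂ c ; (inj₂ c) → inj₁ c }) cov)
          (s′ , W′ , lt , cov′) = red Φₗ covₗ Γ
      in map (_⊖ g) gs ∷ s′
       , (All.map⁺ (All.map (λ D → Deg-⊖ (suc d) D (Deg-suc d Dg)) Dgs) , W′)
       , next (List.length-map (_⊖ g) gs) lt
       , All.tabulate λ {φ} φ∈ → case-sort cov′ (Covers⇒Deg (gs ∷ s) (Dgs , W) (All.lookup cov φ∈))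
                                   (All.lookup sort φ∈)
      where
      case-sort : ∀ {Φₗ s′ φ} → All (λ φ → All (λ h → Covers₀ s′ (shift h φ ⊖ g)) Γ) Φₗ →
                  Deg (suc d) φ → φ ∈ₗ Φₗ ⊎ Any (λ g → Deg d (φ ⊖ g)) gs →
                  All (λ h → Covers₀ (map (_⊖ g) gs ∷ s′) (shift h φ ⊖ g)) Γ
      case-sort cov′ D (inj₁ φ∈) =
        All.map (λ { (inj₁ c) → inj₁ (inj₂ c) ; (inj₂ c) → inj₂ c }) (All.lookup cov′ φ∈)
      case-sort cov′ D (inj₂ c)  =
        All.tabulate λ {h} _ → inj₁ (inj₁ (Any.map⁺ (Any.map (Deg-shift-⊖ h D) c)))
  reduce {suc d} ([] ∷ s) (Dgs , W) | inj₁ none =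
    inj₁ λ { φ (inj₁ ()) ; φ (inj₂ c) → none φ c }
  reduce {suc d} ((g ∷ gs) ∷ s) (Dg ∷ Dgs , W) | inj₁ none = inj₂ (g , Dg , red)
    where
    red : ∀ Φ → All (Covers ((g ∷ gs) ∷ s)) Φ → ∀ Γ → _
    red Φ cov Γ =
      let (Φ₁ , D₁ , sort) = split (All.map first cov)
          Ψ  = concatMap (λ φ → map (λ h → shift h φ ⊖ g) Γ) Φ₁
          DΨ : All (Deg d) Ψ
          DΨ = All.concat⁺ (All.map⁺ (All.map (λ {φ} (D , D′) →
                 All.map⁺ (All.tabulate λ {h} _ → same-class {φ} h D D′)) D₁))
      in map (_⊖ g) gs ∷ top d Ψ
       , (All.map⁺ (All.map (λ D → Deg-⊖ (suc d) D Dg) Dgs) , top-wellDegreed d DΨ)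
       , this (ℕ.≤-reflexive (cong suc (List.length-map (_⊖ g) gs))) refl
       , All.tabulate λ φ∈ → case-sort Φ₁ (top-covers d DΨ) (All.lookup sort φ∈)
      where
      B : Map → Set
      B φ = Deg (suc d) φ × Any (λ g → Deg d (φ ⊖ g)) gs
      first : ∀ {φ} → Covers ((g ∷ gs) ∷ s) φ → (Deg (suc d) φ × Deg d (φ ⊖ g)) ⊎ B φ
      first c@(inj₁ (here D))  = inj₁ (Covers⇒Deg ((g ∷ gs) ∷ s) (Dg ∷ Dgs , W) c , D)
      first c@(inj₁ (there a)) = inj₂ (Covers⇒Deg ((g ∷ gs) ∷ s) (Dg ∷ Dgs , W) c , a)
      first (inj₂ c)           = ⊥-elim (none _ c)
      same-class : ∀ {φ} h → Deg (suc d) φ → Deg d (φ ⊖ g) → Deg d (shift h φ ⊖ g)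
      same-class {φ} h D D′ =
        Deg-resp d (λ u → rearrange (φ u) (g u) (shift h φ u)) (Deg-+ d D′ (Deg-shift h D))
        where
        rearrange : ∀ a b c → a ℤ.- b ℤ.+ (c ℤ.- a) ≡ c ℤ.- b
        rearrange = solve-∀
      case-sort : ∀ {s′ φ} Φ₁ →
                  All (Covers₀ s′) (concatMap (λ φ → map (λ h → shift h φ ⊖ g) Γ) Φ₁) →
                  φ ∈ₗ Φ₁ ⊎ B φ →
                  All (λ h → Covers₀ (map (_⊖ g) gs ∷ s′) (shift h φ ⊖ g)) Γ
      case-sort {s′} {φ} Φ₁ cov′ (inj₁ φ∈) = All.map lift
        (All.map⁻ (All.lookup (All.map⁻
          (All.concat⁻ {xss = map (λ φ → map (λ h → shift h φ ⊖ g) Γ) Φ₁} cov′)) φ∈))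
        where
        lift : ∀ {ψ} → Covers₀ s′ ψ → Covers₀ (map (_⊖ g) gs ∷ s′) ψ
        lift (inj₁ c) = inj₁ (inj₂ c)
        lift (inj₂ c) = inj₂ c
      case-sort Φ₁ cov′ (inj₂ (D , c)) =
        All.tabulate λ {h} _ → inj₁ (inj₁ (Any.map⁺ (Any.map (Deg-shift-⊖ h D) c)))

-- Polynomial recurrence along an ultrafilter

module _ {X : Set} (p : Ultrafilter X) where

  member-all : ∀ {A : Pred X 0ℓ} → (∀ x → A x) → A ∈ᵤ p
  member-all {A} all with ultra p A
  ... | inj₁ A∈ = A∈
  ... | inj₂ ∁A∈ = let (x , ¬Ax) = inhabited p ∁A∈ in contradiction (all x) ¬Ax

  member-All : ∀ {I : Set} {D : I → Pred X 0ℓ} {is} → All (λ i → D i ∈ᵤ p) is →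
               (λ x → All (λ i → D i x) is) ∈ᵤ p
  member-All []         = member-all (λ _ → [])
  member-All (D∈ ∷ Ds∈) = upward p (λ (d , ds) → d ∷ ds) (meet p D∈ (member-All Ds∈))

  member-Any : ∀ {I : Set} {D : I → Pred X 0ℓ} is → (λ x → Any (λ i → D i x) is) ∈ᵤ p →
               Any (λ i → D i ∈ᵤ p) is
  member-Any []       ∅∈ with () ← proj₂ (inhabited p ∅∈)
  member-Any {D = D} (i ∷ is) A∈ with ultra p (D i)
  ... | inj₁ D∈  = here D∈
  ... | inj₂ ∁D∈ = there (member-Any is (upward p
    (λ { (¬d , here d) → contradiction d ¬d ; (_ , there ds) → ds }) (meet p ∁D∈ A∈)))

  lem : (P : Set) → Dec P
  lem P with ultra p (λ _ → P)
  ... | inj₁ P∈  = yes (proj₂ (inhabited p P∈))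
  ... | inj₂ ¬P∈ = no (proj₂ (inhabited p ¬P∈))

module Recurrence
  (p : βℕ)
  (M : Set) (_⊞_ : M → M → M)
  -- Gen m m′ u: the element u is generated by a set of indices between m and m′.
  (Gen : ℕ → ℕ → M → Set)
  (gen-new    : ∀ m → Σ[ m′ ∈ ℕ ] Σ[ u ∈ M ] Gen m m′ u)
  (gen-≤      : ∀ {m m′ u} → Gen m m′ u → m ≤ m′)
  (gen-weaken : ∀ {l m m′ u} → l ≤ m → Gen m m′ u → Gen l m′ u)
  (gen-join   : ∀ {l m m′ u v} → Gen l m v → Gen m m′ u → Gen l m′ (u ⊞ v))
  where

  record W (E : Pred ℤ 0ℓ) (x : ℤ) : Set where
    constructor ⟨_⟩
    field
      translates : (λ n → E (toℤ n ℤ.+ x)) ∈ᵤ p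

  open W public

  module _
    (syndetic : ∀ E {x} → W E x → Σ[ ts ∈ List ℤ ] ∀ y → Any (λ t → W E (y ℤ.+ t)) ts)
    where

    open PolynomialMaps _⊞_

    -- Quantifying over `E` lets the induction hypothesis apply to an intersection of translates of
    -- `E`; quantifying over `m` keeps the index sets of successive rounds disjoint.
    Recurrent : List Map → Set₁
    Recurrent Φ = ∀ E {x} → W E x → ∀ m →
      Σ[ m′ ∈ ℕ ] Σ[ u ∈ M ] Gen m m′ u ×
      Σ[ y ∈ ℤ ] W E y × All (λ φ → W E (y ℤ.+ φ u)) Φ

    W-All⁺ : ∀ {E x cs} → All (λ c → W E (x ℤ.+ c)) cs → W (λ z → All (λ c → E (z ℤ.+ c)) cs) x
    W-All⁺ {E} {x} ws = ⟨ upward p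
      (λ {n} → All.map λ {c} → subst E (sym (ℤ.+-assoc (toℤ n) x c)))
      (member-All p (All.map translates ws)) ⟩

    W-All⁻ : ∀ {E x cs} → W (λ z → All (λ c → E (z ℤ.+ c)) cs) x → ∀ {c} → c ∈ₗ cs → W E (x ℤ.+ c)
    W-All⁻ {E} {x} w {c} c∈ = ⟨ upward p
      (λ {n} es → subst E (ℤ.+-assoc (toℤ n) x c) (All.lookup es c∈)) (translates w) ⟩

    module Step {d : ℕ} (s : System d) (W-s : WellDegreed s)
      (IH : ∀ (s′ : System d) → WellDegreed s′ → weight s′ ⊏ weight s →
            ∀ Φ → All (Covers₀ s′) Φ → Recurrent Φ)
      where

      module _ {Φ : List Map} (cov : All (Covers s) Φ) (reducible : Reducible s)
               (E : Pred ℤ 0ℓ) {x : ℤ} (Wx : W E x) (m : ℕ) where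

        g : Map
        g = proj₁ reducible

        Result : Set
        Result = Σ[ m′ ∈ ℕ ] Σ[ u ∈ M ] Gen m m′ u ×
                 Σ[ y ∈ ℤ ] W E y × All (λ φ → W E (y ℤ.+ φ u)) Φ

        ts : List ℤ
        ts = proj₁ (syndetic E Wx)

        -- An earlier round (t , γ) had colour t, and all z + φ γ have that colour too.
        Focus : ℕ → ℤ → ℤ × M → Set
        Focus m₁ z (t , γ) = Gen m m₁ γ × All (λ φ → W E (z ℤ.+ φ γ ℤ.+ t)) Φ

        -- One round applies the induction hypothesis to the maps `shift h φ ⊖ g` and to the
        -- intersection `E′` of all translates of `E` known to have `z` as a point. With
        -- `z′ = y - g u`, the sum `z′ + φ (u ⊞ γ) + t′` splits into `y + (φ (u ⊞ γ) - φ γ - g u)`,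
        -- a point of `E′`, and `φ γ + t′`, one of the translations defining `E′`. So the old rounds
        -- survive with `γ` replaced by `u ⊞ γ`.
        extend : ∀ z {past m₁ t} → m ≤ m₁ → W E (z ℤ.+ t) → All (Focus m₁ z) past →
                 Σ[ u ∈ M ] Σ[ m₂ ∈ ℕ ] Σ[ z′ ∈ ℤ ] m ≤ m₂ ×
                 All (Focus m₂ z′) ((t , u) ∷ map (λ (t′ , γ) → t′ , u ⊞ γ) past)
        extend z {past} {m₁} {t} m≤m₁ Wt foci =
          let (s′ , W′ , lt , covs) = proj₂ (proj₂ reducible) Φ cov Γ
              (m₂ , u , gu , y , _ , hits) =
                IH s′ W′ lt Ψ (All.concat⁺ (All.map⁺ (All.map All.map⁺ covs))) E′ WE′ m₁
              hit : ∀ {φ h} → φ ∈ₗ Φ → h ∈ₗ Γ → W E′ (y ℤ.+ (shift h φ u ℤ.- g u))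
              hit φ∈ h∈ =
                All.lookup (All.map⁻ (All.lookup (All.map⁻ (All.concat⁻ {xss = map rows Φ} hits)) φ∈)) h∈
          in u , m₂ , y ℤ.- g u , ℕ.≤-trans m≤m₁ (gen-≤ gu) ,
             (gen-weaken m≤m₁ gu ,
              All.tabulate λ {φ} φ∈ → subst (W E) (fresh y (φ u) (g u) t)
                (W-All⁻ (hit φ∈ (here refl)) (here refl))) ∷
             All.map⁺ (All.tabulate λ {(t′ , γ)} i →
               gen-join (proj₁ (All.lookup foci i)) gu ,
               All.tabulate λ {φ} φ∈ → subst (W E) (shifted y (φ (u ⊞ γ)) (φ γ) (g u) t′)
                 (W-All⁻ (hit φ∈ (there (∈ₗ.∈-map⁺ (just ∘ proj₂) i)))
                   (there (∈ₗ.∈-concatMap⁺ _ (Any.map (λ { refl → ∈ₗ.∈-map⁺ _ φ∈ }) i)))))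
          where
          Γ = nothing ∷ map (just ∘ proj₂) past
          rows : Map → List Map
          rows φ = map (λ h → shift h φ ⊖ g) Γ
          Ψ = concatMap rows Φ
          cs = t ∷ concatMap (λ (t′ , γ) → map (λ φ → φ γ ℤ.+ t′) Φ) past
          E′ : Pred ℤ 0ℓ
          E′ z = All (λ c → E (z ℤ.+ c)) cs
          WE′ : W E′ z
          WE′ = W-All⁺ (Wt ∷ All.concat⁺ (All.map⁺ (All.map (λ {(t′ , γ)} (_ , ws) →
                  All.map⁺ (All.map (λ {φ} → subst (W E) (ℤ.+-assoc z (φ γ) t′)) ws)) foci)))
          fresh : ∀ y a b t → y ℤ.+ (a ℤ.- b) ℤ.+ t ≡ y ℤ.- b ℤ.+ a ℤ.+ t
          fresh = solve-∀
          shifted : ∀ y a c b t → y ℤ.+ (a ℤ.- c ℤ.- b) ℤ.+ (c ℤ.+ t) ≡ y ℤ.- b ℤ.+ a ℤ.+ t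
          shifted = solve-∀

        -- When a colour `t` recurs, `z + t` is the point sought: the earlier round of that colour
        -- already makes every `z + φ γ + t` a point of `E`.
        finish : ∀ z {past m₁ t} → All (Focus m₁ z) past → W E (z ℤ.+ t) →
                 t ∈ₗ map proj₁ past → Result
        finish z {t = t} (focus ∷ _) Wt (here refl) =
          let (gen , ws) = focus
          in _ , _ , gen , z ℤ.+ t , Wt ,
             All.map (λ {φ} → subst (W E) (swap z (φ _) t)) ws
          where
          swap : ∀ z a t → z ℤ.+ a ℤ.+ t ≡ z ℤ.+ t ℤ.+ a
          swap = solve-∀
        finish z (_ ∷ foci) Wt (there t∈) = finish z foci Wt t∈

        -- Colour focusing: each round either revisits the colour of an earlier
        -- round, or consumes one of the colours not seen so far.
        focus : ∀ n z {past m₁ t} unseen → length unseen ≤ n → m ≤ m₁ →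
                W E (z ℤ.+ t) → All (Focus m₁ z) past →
                (∀ {t′} → t′ ∈ₗ ts → t′ ∈ₗ unseen ⊎ t′ ∈ₗ t ∷ map proj₁ past) → Result
        focus n z {past} {t = t} unseen len m≤m₁ Wt foci seen =
          let (u , m₂ , z′ , m≤m₂ , foci′) = extend z m≤m₁ Wt foci
              (t″ , t″∈ , Wt″) = find (proj₂ (syndetic E Wx) z′)
          in next-round u z′ m≤m₂ foci′ Wt″ (seen t″∈) n len
          where
          times : ∀ u t′ → t′ ∈ₗ t ∷ map proj₁ past →
                  t′ ∈ₗ t ∷ map proj₁ (map (λ (t′ , γ) → t′ , u ⊞ γ) past)
          times u t′ = subst (λ l → t′ ∈ₗ t ∷ l) (List.map-∘ past)
          next-round : ∀ u z′ {m₂ t″} → m ≤ m₂ →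
                       All (Focus m₂ z′) ((t , u) ∷ map (λ (t′ , γ) → t′ , u ⊞ γ) past) →
                       W E (z′ ℤ.+ t″) → t″ ∈ₗ unseen ⊎ t″ ∈ₗ t ∷ map proj₁ past →
                       ∀ n → length unseen ≤ n → Result
          next-round u z′ m≤m₂ foci′ Wt″ (inj₂ t″∈) n len = finish z′ foci′ Wt″ (times u _ t″∈)
          next-round u z′ m≤m₂ foci′ Wt″ (inj₁ t″∈) n len with ∈ₗ.∈-∃++ t″∈
          next-round u z′ m≤m₂ foci′ Wt″ (inj₁ t″∈) zero len | [] , ys , refl with () ← len
          next-round u z′ m≤m₂ foci′ Wt″ (inj₁ t″∈) zero len | (_ ∷ _) , ys , refl with () ← len
          next-round u z′ {t″ = t″} m≤m₂ foci′ Wt″ (inj₁ t″∈) (suc n) len | xs , ys , refl =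
            focus n z′ (xs ++ ys) (ℕ.≤-pred (subst (ℕ._≤ suc n) (List.length-++-sucʳ xs t″ ys) len))
              m≤m₂ Wt″ foci′ (λ t′∈ → remaining (seen t′∈))
            where
            remaining : ∀ {t′} → t′ ∈ₗ xs ++ t″ ∷ ys ⊎ t′ ∈ₗ t ∷ map proj₁ past →
                        t′ ∈ₗ xs ++ ys ⊎ t′ ∈ₗ t″ ∷ t ∷ map proj₁ (map (λ (t′ , γ) → t′ , u ⊞ γ) past)
            remaining (inj₂ t′∈) = inj₂ (there (times u _ t′∈))
            remaining (inj₁ t′∈) with ∈ₗ.∈-++⁻ xs t′∈
            ... | inj₁ i         = inj₁ (∈ₗ.∈-++⁺ˡ i)
            ... | inj₂ (here e)  = inj₂ (here e)
            ... | inj₂ (there i) = inj₁ (∈ₗ.∈-++⁺ʳ xs i)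

        focused : Result
        focused =
          let (t , _ , Wt) = find (proj₂ (syndetic E Wx) x)
          in focus (length ts) x ts ℕ.≤-refl ℕ.≤-refl Wt [] inj₁

      recurrent-covered : ∀ Φ → All (Covers s) Φ → Recurrent Φ
      recurrent-covered Φ cov E {x} Wx m with reduce s W-s
      ... | inj₂ r    = focused cov r E Wx m
      -- Here `Φ` has no members, so any generator works with the given point.
      ... | inj₁ none =
        let (m′ , u , gu) = gen-new m
        in m′ , u , gu , x , Wx , All.map (λ {φ} c → contradiction c (none φ)) cov

      recurrent-step : ∀ Φ → All (Covers₀ s) Φ → Recurrent Φ
      recurrent-step Φ cov E Wx m =
        let (Φ⁺ , cov⁺ , sort) = split cov
            (m′ , u , gu , y , Wy , ws) = recurrent-covered Φ⁺ cov⁺ E Wx m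
        in m′ , u , gu , y , Wy ,
           All.map (λ { (inj₁ φ∈) → All.lookup ws φ∈
                      ; (inj₂ (vanish φ≡0)) → subst (W E)
                          (sym (trans (cong (λ a → y ℤ.+ a) (φ≡0 u)) (ℤ.+-identityʳ y))) Wy }) sort

    recurrent : ∀ {d} (s : System d) → WellDegreed s → ∀ Φ → All (Covers₀ s) Φ → Recurrent Φ
    recurrent s W-s = go s W-s (⊏-wellFounded (weight s))
      where
      go : ∀ {d} (s : System d) → WellDegreed s → Acc _⊏_ (weight s) →
           ∀ Φ → All (Covers₀ s) Φ → Recurrent Φ
      go s W-s (acc rs) = Step.recurrent-step s W-s λ s′ W′ lt → go s′ W′ (rs lt)

-- Minimal idempotents belong to 𝒥ₚ

value-injective : ∀ {m n : ℕ⁺} → value m ≡ value n → m ≡ n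
value-injective {pos _} {pos _} refl = refl

+⁺-assoc : ∀ l m n → (l +⁺ m) +⁺ n ≡ l +⁺ (m +⁺ n)
+⁺-assoc l m n = value-injective (ℕ.+-assoc (value l) (value m) (value n))

0<value : ∀ (n : ℕ⁺) → 0 < value n
0<value (pos n) = >-nonZero⁻¹ n

∈⇒≤sum : ∀ {n ns} → n ∈ₗ ns → n ≤ sum ns
∈⇒≤sum {n} {ns = _ ∷ ns} (here refl) = ℕ.m≤m+n n (sum ns)
∈⇒≤sum {ns = m ∷ ns}     (there n∈)  = ℕ.≤-trans (∈⇒≤sum n∈) (ℕ.m≤n+m (sum ns) m)

positive-translate : ∀ (n : ℕ⁺) y → ℤ.∣ y ∣ < value n → Σ[ n′ ∈ ℕ⁺ ] toℤ n′ ≡ toℤ n ℤ.+ y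
positive-translate n (+ k)      _  =
  pos (value n ℕ.+ k) {{>-nonZero (ℕ.≤-trans (0<value n) (ℕ.m≤m+n (value n) k))}} , refl
positive-translate n ℤ.-[1+ k ] lt =
  pos (value n ℕ.∸ suc k) {{>-nonZero (ℕ.m<n⇒0<n∸m lt)}} , sym (ℤ.⊖-≥ (ℕ.<⇒≤ lt))

eval-zero : ∀ P → (∀ i → coeff P i ≡ 0ℤ) → ∀ x → eval P x ≡ 0ℤ
eval-zero []       _ x = refl
eval-zero (c ∷ cs) e x = trans
  (cong (x ℤ.*_) (cong₂ ℤ._+_ (e 0) (eval-zero cs (e ∘ suc) x))) (ℤ.*-zeroʳ x)

eval-cong : ∀ P Q → (∀ i → coeff P i ≡ coeff Q i) → ∀ x → eval P x ≡ eval Q x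
eval-cong []       Q        e x = sym (eval-zero Q (sym ∘ e) x)
eval-cong (c ∷ cs) []       e x = eval-zero (c ∷ cs) e x
eval-cong (c ∷ cs) (d ∷ ds) e x =
  cong (x ℤ.*_) (cong₂ ℤ._+_ (e 0) (eval-cong cs ds (e ∘ suc) x))

∑-cong : ∀ β {f g : ℕ⁺ → ℕ} → (∀ i → f i ≡ g i) → ∑ β f ≡ ∑ β g
∑-cong β e = cong sum (List.map-cong e (toList (elements β)))

module _ (p : βℕ) (idem : Idempotent p) where

  -- An idempotent is nonprincipal, since `x + x = x` has no positive solution.
  cofinite : ∀ N → (λ n → N < value n) ∈ᵤ p
  cofinite zero    = member-all p 0<value
  cofinite (suc N) with ultra p (λ n → value n ≡ suc N)
  ... | inj₂ ≢∈ = upward p (λ (lt , ≢) → ℕ.≤∧≢⇒< lt (≢ ∘ sym)) (meet p (cofinite N) ≢∈)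
  ... | inj₁ ≡∈ =
    let (x , x≡ , A∈) = inhabited p (meet p ≡∈ (from (idem _) ≡∈))
        (y , y≡ , +≡) = inhabited p (meet p ≡∈ A∈)
    in contradiction (trans (sym (cong₂ ℕ._+_ x≡ y≡)) +≡) (ℕ.m+1+n≢m (suc N))

module MinimalIdempotents (p : βℕ) (minimal : MinimalIdempotent p) where

  idem : Idempotent p
  idem = proj₁ minimal

  L : Pred βℕ (lsuc 0ℓ)
  L = proj₁ (proj₂ minimal)

  L-minimal : IsMinimalLeftIdeal L
  L-minimal = proj₁ (proj₂ (proj₂ minimal))

  Lp : L p
  Lp = proj₂ (proj₂ (proj₂ minimal))

  open IsLeftIdeal (proj₁ L-minimal)

  -- βℕ ⊕ (r ⊕ p) is a left ideal inside `L`, so by minimality it contains `p`.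
  absorbed : ∀ r → Σ[ q ∈ βℕ ] p ≈ᵤ q ⊕ (r ⊕ p)
  absorbed r = proj₂ L-minimal L′ L′-ideal
    (λ (q , e) → respects (λ A → sym-⇔ (e A)) (absorbs q (absorbs r Lp))) Lp
    where
    sym-⇔ : ∀ {A B : Set} → A ⇔ B → B ⇔ A
    sym-⇔ e = mk⇔ (from e) (to e)
    L′ : Pred βℕ (lsuc 0ℓ)
    L′ s = Σ[ q ∈ βℕ ] s ≈ᵤ q ⊕ (r ⊕ p)
    L′-ideal : IsLeftIdeal L′
    L′-ideal = record
      { respects = λ s≈t (q , e) → q , λ A → mk⇔ (to (e A) ∘ from (s≈t A)) (to (s≈t A) ∘ from (e A))
      ; nonempty = p ⊕ (r ⊕ p) , p , λ A → mk⇔ id id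
      ; absorbs  = λ q′ (q , e) → q′ ⊕ q , λ A → mk⇔
          (upward q′ λ {x} m →
             upward q (λ {y} → upward (r ⊕ p) λ {z} → subst A (sym (+⁺-assoc x y z)))
                                 (to (e _) m))
          (upward q′ λ {x} m → from (e _)
             (upward q (λ {y} → upward (r ⊕ p) λ {z} → subst A (+⁺-assoc x y z)) m))
      }

  -- With `u` a functional, ⊞ is pointwise addition and evaluation at a sequence is additive by
  -- computation; one `u` serves all sequences at once.
  record Generated (m m′ : ℕ) (u : (ℕ⁺ → ℕ⁺) → ℕ) : Set where
    field
      support : FinSet Pos
      within  : All (λ i → m < value i × value i ≤ m′) (toList (elements support))
      sums    : ∀ f → u f ≡ ∑ support (value ∘ f)

  open Generated

  generated-≤ : ∀ {m m′ u} → Generated m m′ u → m ≤ m′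
  generated-≤ g with elements (support g) | within g
  ... | _ ∷ _ | (lt , le) ∷ _ = ℕ.≤-trans (ℕ.<⇒≤ lt) le

  generated-weaken : ∀ {l m m′ u} → l ≤ m → Generated m m′ u → Generated l m′ u
  generated-weaken l≤m g = record
    { support = support g
    ; within  = All.map (λ (lt , le) → ℕ.≤-<-trans l≤m lt , le) (within g)
    ; sums    = sums g
    }

  generated-new : ∀ m → Σ[ m′ ∈ ℕ ] Σ[ u ∈ _ ] Generated m m′ u
  generated-new m = suc m , (λ f → value (f (pos (suc m))) ℕ.+ 0) , record
    { support = record { elements = pos (suc m) ∷ [] ; unique = [] ∷ [] }
    ; within  = (ℕ.≤-refl , ℕ.≤-refl) ∷ []
    ; sums    = λ f → refl
    }

  generated-join : ∀ {l m m′ u v} → Generated l m v → Generated m m′ u →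
                   Generated l m′ (λ f → u f ℕ.+ v f)
  generated-join {l} {m} {m′} {u} {v} g h
    with support g in g≡ | support h in h≡ | within g | within h
  ... | record { elements = i ∷ is ; unique = ui } | record { elements = j ∷ js ; unique = uj }
      | wi | wj = record
    { support = record
        { elements = j ∷ js ++ i ∷ is
        ; unique   = Unique.++⁺ Pos uj ui λ (k∈js , k∈is) →
            ℕ.<⇒≱ (proj₁ (All.lookup wj k∈js)) (proj₂ (All.lookup wi k∈is))
        }
    ; within = All.++⁺ (All.map (λ (lt , le) → ℕ.≤-<-trans (generated-≤ g) lt , le) wj)
                       (All.map (λ (lt , le) → lt , ℕ.≤-trans le (generated-≤ h)) wi)
    ; sums = λ f → begin
        u f ℕ.+ v f
          ≡⟨ cong₂ ℕ._+_ (trans (sums h f) (cong (λ β → ∑ β (value ∘ f)) h≡))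
                         (trans (sums g f) (cong (λ β → ∑ β (value ∘ f)) g≡)) ⟩
        sum (map (value ∘ f) (j ∷ js)) ℕ.+ sum (map (value ∘ f) (i ∷ is))
          ≡⟨ sum-++ (map (value ∘ f) (j ∷ js)) _ ⟨
        sum (map (value ∘ f) (j ∷ js) ++ map (value ∘ f) (i ∷ is))
          ≡⟨ cong sum (List.map-++ (value ∘ f) (j ∷ js) (i ∷ is)) ⟨
        sum (map (value ∘ f) (j ∷ js ++ i ∷ is)) ∎
    }
    where open ≡-Reasoning

  open Recurrence p _ (λ u v f → u f ℕ.+ v f) Generated
    generated-new generated-≤ generated-weaken generated-join

  module _ (E : Pred ℤ 0ℓ) {x : ℤ} (Wx : W E x) where

    shifts : ℕ → List ℤ
    shifts N = map (λ i → + i ℤ.+ x) (upTo (suc N))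

    syndetic⁺ : Σ[ N ∈ ℕ ] ∀ (n : ℕ⁺) → Any (λ t → W E (toℤ n ℤ.+ t)) (shifts N)
    syndetic⁺ with lem p (Σ[ N ∈ ℕ ] ∀ (n : ℕ⁺) → Any (λ t → W E (toℤ n ℤ.+ t)) (shifts N))
    ... | yes S = S
    -- A witness to the failure of each bound N gives a sequence, whose limit along p
    -- is an ultrafilter r with p ∉ βℕ ⊕ (r ⊕ p).
    ... | no ¬S = contradiction (lose (∈ₗ.∈-map⁺ _ (∈ₗ.∈-upTo⁺ a<n)) Wa) (proj₂ (gap (value n)))
      where
      gap : ∀ N → Σ[ n ∈ ℕ⁺ ] ¬ Any (λ t → W E (toℤ n ℤ.+ t)) (shifts N)
      gap N with lem p (Σ[ n ∈ ℕ⁺ ] ¬ Any (λ t → W E (toℤ n ℤ.+ t)) (shifts N))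
      ... | yes g = g
      ... | no ¬g = contradiction (N , λ n → covered n) ¬S
        where
        covered : ∀ n → Any (λ t → W E (toℤ n ℤ.+ t)) (shifts N)
        covered n with lem p (Any (λ t → W E (toℤ n ℤ.+ t)) (shifts N))
        ... | yes c = c
        ... | no ¬c = contradiction (n , ¬c) ¬g
      gaps : ℕ⁺ → ℕ⁺
      gaps n = proj₁ (gap (value n))
      q : βℕ
      q = proj₁ (absorbed (image gaps p))
      qA : (λ n → E (toℤ n ℤ.+ x)) ∈ᵤ q ⊕ (image gaps p ⊕ p)
      qA = to (proj₂ (absorbed (image gaps p)) _) (translates Wx)
      a : ℕ⁺
      a = proj₁ (inhabited q qA)
      -- Taking `n` beyond `a` puts `a + x` among the shifts that `gaps n` avoids.
      hit : Σ[ n ∈ ℕ⁺ ] value a < value n ×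
            (λ k → E (toℤ (a +⁺ (gaps n +⁺ k)) ℤ.+ x)) ∈ᵤ p
      hit = inhabited p (meet p (cofinite p idem (value a)) (proj₂ (inhabited q qA)))
      n : ℕ⁺
      n = proj₁ hit
      a<n : value a < suc (value n)
      a<n = ℕ.m≤n⇒m≤1+n (proj₁ (proj₂ hit))
      Wa : W E (toℤ (gaps n) ℤ.+ (toℤ a ℤ.+ x))
      Wa = ⟨ upward p (λ {k} → subst E (rearrange (toℤ a) (toℤ (gaps n)) (toℤ k) x))
               (proj₂ (proj₂ hit)) ⟩
        where
        rearrange : ∀ a b k x → a ℤ.+ (b ℤ.+ k) ℤ.+ x ≡ k ℤ.+ (b ℤ.+ (a ℤ.+ x))
        rearrange = solve-∀

    -- For p-many `n` the integer `n + y` is positive, so `syndetic⁺` applies to it. By pigeonhole a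
    -- single `t` serves p-many `n`, and idempotence absorbs the additional summand `n`.
    syndetic : Σ[ ts ∈ List ℤ ] ∀ y → Any (λ t → W E (y ℤ.+ t)) ts
    syndetic = let (N , cover) = syndetic⁺ in shifts N , λ y →
      Any.map (λ {t} → collapse y t)
        (member-Any p (shifts N) (upward p (λ {n} lt →
          let (n′ , n′≡) = positive-translate n y lt
          in Any.map (λ {t} → subst (λ z → W E (z ℤ.+ t)) n′≡) (cover n′))
          (cofinite p idem ℤ.∣ y ∣)))
      where
      collapse : ∀ y t → (λ n → W E (toℤ n ℤ.+ y ℤ.+ t)) ∈ᵤ p → W E (y ℤ.+ t)
      collapse y t w = ⟨ to (idem (λ n → E (toℤ n ℤ.+ (y ℤ.+ t))))
        (upward p (λ {n} w → upward p (λ {k} →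
          subst E (rearrange (toℤ k) (toℤ n) y t)) (translates w)) w) ⟩
        where
        rearrange : ∀ k n y t → k ℤ.+ (n ℤ.+ y ℤ.+ t) ≡ n ℤ.+ k ℤ.+ (y ℤ.+ t)
        rearrange = solve-∀

  open PolynomialMaps {M = (ℕ⁺ → ℕ⁺) → ℕ} (λ u v f → u f ℕ.+ v f)

  -- Membership of `A` in `p` says that 0 is a point of `A`. Recurrence from there gives an integer
  -- `y`, possibly negative; adding a large `n` common to all the resulting members of `p` yields
  -- the positive `a`.
  minimalIdempotent∈𝒥ₚ : 𝒥ₚ p
  minimalIdempotent∈𝒥ₚ A A∈ F H =
    let (_ , u , gen , y , _ , hits) =
          recurrent syndetic (top d Φ) (top-wellDegreed d Φ-deg) Φ (top-covers d Φ-deg) E {0ℤ} W0 0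
        (n , y<n , Es) = inhabited p (meet p (cofinite p idem ℤ.∣ y ∣)
                           (member-All p (All.map translates hits)))
        (a , a≡) = positive-translate n y y<n
    in a , support gen , λ P f P∈ f∈ → All.lookupWith
         (λ {f′} Ps f≈f′ → All.lookupWith
           (λ {P′} e P≈P′ → subst (_∈ℤ A)
             (begin
               toℤ n ℤ.+ (y ℤ.+ eval P′ (+ u f′))
                 ≡⟨ ℤ.+-assoc (toℤ n) y _ ⟨
               toℤ n ℤ.+ y ℤ.+ eval P′ (+ u f′)
                 ≡⟨ cong₂ ℤ._+_ a≡ (eval-cong P P′ P≈P′ (+ u f′)) ⟨
               toℤ a ℤ.+ eval P (+ u f′)
                 ≡⟨ cong (λ s → toℤ a ℤ.+ eval P (+ s))
                      (trans (sums gen f′) (∑-cong (support gen) (λ i → cong value (sym (f≈f′ i))))) ⟩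
               toℤ a ℤ.+ eval P (+ ∑ (support gen) (value ∘ f)) ∎) e)
           (All.map⁻ Ps) P∈)
         (All.map⁻ (All.concat⁻ {xss = map row (toList (elements H))} Es)) f∈
    where
    open ≡-Reasoning
    E : Pred ℤ 0ℓ
    E z = z ∈ℤ A
    W0 : W E 0ℤ
    W0 = ⟨ upward p (λ {n} An → n , sym (ℤ.+-identityʳ (toℤ n)) , An) A∈ ⟩
    row : (ℕ⁺ → ℕ⁺) → List Map
    row f = map (λ P u → eval P (+ u f)) (toList (elements F))
    Φ = concatMap row (toList (elements H))
    -- The sum of the lengths is a common degree bound.
    d = sum (map length (toList (elements F)))
    Φ-deg : All (Deg d) Φ
    Φ-deg = All.concat⁺ (All.map⁺ {f = row} (All.universal (λ f →
              All.map⁺ (All.tabulate {xs = toList (elements F)} λ {P} P∈ →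
                Deg-mono (∈⇒≤sum (∈ₗ.∈-map⁺ length P∈))
                  (Deg-eval (λ u → + u f) (λ u v → refl) P))) (toList (elements H))))

-- Choice and finite sets

-- Choice of a witness that depends on the predicate only up to equivalence,
-- so that chosen values respect setoid equalities.
record Choice (X : Set) : Set₁ where
  field
    ε       : Pred X 0ℓ → X
    ε-sound : ∀ {P : Pred X 0ℓ} → Σ[ x ∈ X ] P x → P (ε P)
    ε-cong  : ∀ {P Q : Pred X 0ℓ} → (∀ x → P x ⇔ Q x) → ε P ≡ ε Q

open Choice

open Choice

choice-retract : ∀ {X Y} (f : X → Y) (g : Y → X) → (∀ y → f (g y) ≡ y) → Choice X → Choice Y
choice-retract f g fg cX = record
  { ε       = λ P → f (ε cX (P ∘ f))
  ; ε-sound = λ {P} (y , Py) → ε-sound cX {P ∘ f} (g y , subst P (sym (fg y)) Py)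
  ; ε-cong  = λ {P} {Q} e → cong f (ε-cong cX {P ∘ f} {Q ∘ f} (e ∘ f))
  }

choice-⊤ : Choice ⊤
choice-⊤ = record { ε = λ _ → tt ; ε-sound = proj₂ ; ε-cong = λ _ → refl }

choice-× : ∀ {X Y} → Choice X → Choice Y → Choice (X × Y)
choice-× {X} {Y} cX cY = record
  { ε       = λ P → fst P , snd P (fst P)
  ; ε-sound = λ {P} ((x , y) , Pxy) →
      ε-sound cY {λ y → P (fst P , y)} (ε-sound cX {λ x → Σ[ y ∈ Y ] P (x , y)} (x , y , Pxy))
  ; ε-cong  = λ {P} {Q} e → cong₂ _,_ (fst-cong {P} {Q} e)
      (trans (ε-cong cY {λ y → P (fst P , y)} {λ y → Q (fst P , y)} (λ y → e (fst P , y)))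
             (cong (snd Q) (fst-cong {P} {Q} e)))
  }
  where
  fst : Pred (X × Y) 0ℓ → X
  fst P = ε cX (λ x → Σ[ y ∈ Y ] P (x , y))
  snd : Pred (X × Y) 0ℓ → X → Y
  snd P x = ε cY (λ y → P (x , y))
  fst-cong : ∀ {P Q} → (∀ xy → P xy ⇔ Q xy) → fst P ≡ fst Q
  fst-cong {P} {Q} e = ε-cong cX {λ x → Σ[ y ∈ Y ] P (x , y)} {λ x → Σ[ y ∈ Y ] Q (x , y)} λ x →
    mk⇔ (λ (y , Pxy) → y , to (e (x , y)) Pxy) (λ (y , Qxy) → y , from (e (x , y)) Qxy)

choice-Vec : ∀ {X} → Choice X → ∀ n → Choice (Vec X n)
choice-Vec cX zero    = choice-retract (λ _ → []) (λ _ → tt) (λ { [] → refl }) choice-⊤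
choice-Vec cX (suc n) =
  choice-retract (λ (x , xs) → x ∷ xs) (λ { (x ∷ xs) → x , xs }) (λ { (x ∷ xs) → refl })
    (choice-× cX (choice-Vec cX n))

choice-List : ∀ {X} → Choice ℕ → Choice X → Choice (List X)
choice-List {X} cℕ cX = record
  { ε       = λ P → elems P (len P)
  ; ε-sound = λ {P} (xs , Pxs) →
      ε-sound (choice-Vec cX (len P)) {P ∘ Vec.toList}
        (ε-sound cℕ {λ n → Σ[ v ∈ Vec X n ] P (Vec.toList v)}
          (length xs , Vec.fromList xs , subst P (sym (Vec.toList∘fromList xs)) Pxs))
  ; ε-cong  = λ {P} {Q} e →
      trans (cong Vec.toList
              (ε-cong (choice-Vec cX (len P)) {P ∘ Vec.toList} {Q ∘ Vec.toList} (e ∘ Vec.toList)))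
            (cong (elems Q) (len-cong {P} {Q} e))
  }
  where
  len : Pred (List X) 0ℓ → ℕ
  len P = ε cℕ (λ n → Σ[ v ∈ Vec X n ] P (Vec.toList v))
  elems : Pred (List X) 0ℓ → ℕ → List X
  elems P n = Vec.toList (ε (choice-Vec cX n) (P ∘ Vec.toList))
  len-cong : ∀ {P Q} → (∀ xs → P xs ⇔ Q xs) → len P ≡ len Q
  len-cong {P} {Q} e = ε-cong cℕ
    {λ n → Σ[ v ∈ Vec X n ] P (Vec.toList v)} {λ n → Σ[ v ∈ Vec X n ] Q (Vec.toList v)}
    λ n → mk⇔ (λ (v , Pv) → v , to (e _) Pv) (λ (v , Qv) → v , from (e _) Qv)

module Classical (dec : (P : Set) → Dec P) where

  least : (P : Pred ℕ 0ℓ) → ∀ n → P n → Σ[ m ∈ ℕ ] P m × (∀ k → P k → m ≤ k)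
  least P zero    P0 = zero , P0 , λ _ _ → z≤n
  least P (suc n) Pn with dec (P 0)
  ... | yes P0 = zero , P0 , λ _ _ → z≤n
  ... | no ¬P0 =
    let (m , Pm , min) = least (P ∘ suc) n Pn
    in suc m , Pm , λ { zero P0 → contradiction P0 ¬P0 ; (suc k) Pk → s≤s (min k Pk) }

  -- The least witness depends only on the extension of the predicate; an empty predicate gets 0.
  choice-ℕ : Choice ℕ
  choice-ℕ = record
    { ε       = λ P → μ P (dec (Σ[ n ∈ ℕ ] P n))
    ; ε-sound = λ {P} w → μ-sound P (dec (Σ[ n ∈ ℕ ] P n)) w
    ; ε-cong  = λ {P} {Q} e → μ-cong e (dec (Σ[ n ∈ ℕ ] P n)) (dec (Σ[ n ∈ ℕ ] Q n))
    }
    where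
    μ : (P : Pred ℕ 0ℓ) → Dec (Σ[ n ∈ ℕ ] P n) → ℕ
    μ P (yes (n , Pn)) = proj₁ (least P n Pn)
    μ P (no _)         = 0
    μ-sound : ∀ P d → Σ[ n ∈ ℕ ] P n → P (μ P d)
    μ-sound P (yes (n , Pn)) _ = proj₁ (proj₂ (least P n Pn))
    μ-sound P (no ¬w)        w = contradiction w ¬w
    μ-cong : ∀ {P Q} → (∀ n → P n ⇔ Q n) → ∀ d d′ → μ P d ≡ μ Q d′
    μ-cong         e (no _)         (no _)         = refl
    μ-cong         e (yes (n , Pn)) (no ¬w)        = contradiction (n , to (e n) Pn) ¬w
    μ-cong         e (no ¬w)        (yes (n , Qn)) = contradiction (n , from (e n) Qn) ¬w
    μ-cong {P} {Q} e (yes (n , Pn)) (yes (n′ , Qn′)) =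
      let (m , Pm , min) = least P n Pn ; (m′ , Qm′ , min′) = least Q n′ Qn′
      in ℕ.≤-antisym (min m′ (from (e m′) Qm′)) (min′ m (to (e m) Pm))

  choice-ℕ⁺ : Choice ℕ⁺
  choice-ℕ⁺ = choice-retract (λ n → pos (suc n)) (ℕ.pred ∘ value)
    (λ { (pos (suc n)) → refl }) choice-ℕ

module FiniteSets (S : Setoid 0ℓ 0ℓ) where

  open Setoid S using (Carrier; _≈_)
  private module S = Setoid S
  open Membership S renaming (_∈_ to _∈ₛ_) using ()

  remove : ∀ {x ys} → x ∈ₛ ys →
           Σ[ zs ∈ List Carrier ] length ys ≡ suc (length zs) × (∀ {z} → z ∈ₛ ys → z ≈ x ⊎ z ∈ₛ zs)
  remove {ys = y ∷ ys} (here x≈y) = ys , refl , λ where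
    (here z≈y)  → inj₁ (S.trans z≈y (S.sym x≈y))
    (there z∈)  → inj₂ z∈
  remove {ys = y ∷ ys} (there x∈) =
    let (zs , len , keep) = remove x∈
    in y ∷ zs , cong suc len , λ where
      (here z≈y) → inj₂ (here z≈y)
      (there z∈) → map₂ there (keep z∈)

  -- Pigeonhole by cancellation: the head of `xs` is removed from `ys`, and by uniqueness the tail
  -- of `xs` stays inside what remains.
  ⊆∧length≥⇒⊇ : ∀ {xs ys} → UniqueSetoid.Unique S xs → (∀ {z} → z ∈ₛ xs → z ∈ₛ ys) →
                length ys ≤ length xs → ∀ {z} → z ∈ₛ ys → z ∈ₛ xs
  ⊆∧length≥⇒⊇ {[]}     {[]}    _         _  _  ()
  ⊆∧length≥⇒⊇ {x ∷ xs} {ys} (x∉ ∷ u) xs⊆ys le z∈ =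
    let (zs , len , keep) = remove (xs⊆ys (here S.refl))
    in [ here , there ∘ ⊆∧length≥⇒⊇ u
         (λ w∈ → [ (λ w≈x → contradiction (S.sym w≈x) (∉×∈⇒≉ x∉ w∈)) , id ]′
                   (keep (xs⊆ys (there w∈))))
         (ℕ.≤-pred (subst (ℕ._≤ suc (length xs)) len le)) ]′ (keep z∈)
    where
    ∉×∈⇒≉ : ∀ {x w xs} → All (λ y → ¬ x ≈ y) xs → w ∈ₛ xs → ¬ x ≈ w
    ∉×∈⇒≉ x∉ w∈ x≈w = All.lookupWith (λ x≉y w≈y → x≉y (S.trans x≈w w≈y)) x∉ w∈

  size : FinSet S → ℕ
  size G = length (toList (elements G))

  ⊊⇒size< : ∀ {F G : FinSet S} → F ⊊ G → size F < size G
  ⊊⇒size< {F} {G} (F⊆G , G⊈F) = ℕ.≰⇒> λ le → G⊈F (⊆∧length≥⇒⊇ (FinSet.unique F) F⊆G le)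

  ⊊-wellFounded : WellFounded (_⊊_ {S})
  ⊊-wellFounded =
    Subrelation.wellFounded (λ {F} {G} → ⊊⇒size< {F} {G}) (On.wellFounded size <-wellFounded)

  module _ (dec : (P : Set) → Dec P) where

    private
      decSetoid : DecSetoid 0ℓ 0ℓ
      decSetoid = record { isDecEquivalence = record
        { isEquivalence = S.isEquivalence ; _≟_ = λ x y → dec (x ≈ y) } }
      _≟_ = DecSetoid._≟_ decSetoid

    fromList : Carrier → List Carrier → FinSet S
    fromList x xs = record
      { elements = x ∷ filter (λ y → ¬? (x ≟ y)) (deduplicate _≟_ xs)
      ; unique   = UniqueDec.deduplicate-! decSetoid (x ∷ xs)
      }

    ∈-fromList⁺ : ∀ {x xs z} → z ∈ₛ x ∷ xs → z ∈ fromList x xs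
    ∈-fromList⁺ = ∈ₛ.∈-deduplicate⁺ S _≟_ (λ z≈y x≈y → S.trans x≈y (S.sym z≈y))

    ∈-fromList⁻ : ∀ {x xs z} → z ∈ fromList x xs → z ∈ₛ x ∷ xs
    ∈-fromList⁻ = ∈ₛ.∈-deduplicate⁻ S _≟_ _

    ∈-fromList : ∀ x xs {z} → z ∈ₗ xs → z ∈ fromList x xs
    ∈-fromList x xs z∈ = ∈-fromList⁺ {x} {xs} (there (Any.map S.reflexive z∈))

    module _ {X : Set} (g : FinSet S → X)
             (g-cong : ∀ F F′ → Setoid._≈_ (𝒫f S) F F′ → g F ≡ g F′) where

      private
        values : List (List Carrier) → List X
        values = concatMap λ { [] → [] ; (x ∷ xs) → g (fromList x xs) ∷ [] }

      -- A subset of `G` equals the sublist of the elements it contains, and `g` respects equality;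
      -- hence finitely many sublists account for all values.
      values-on-subsets : ∀ G → Σ[ xs ∈ List X ] (∀ F → F ⊆ G → g F ∈ₗ xs)
      values-on-subsets G = values (sublists Gs) , covers
        where
        Gs = toList (elements G)
        sublists : List Carrier → List (List Carrier)
        sublists []       = [] ∷ []
        sublists (x ∷ xs) = sublists xs ++ map (x ∷_) (sublists xs)
        module _ (F : FinSet S) (F⊆G : F ⊆ G) where
          ∈F? : ∀ x → Dec (x ∈ F)
          ∈F? x = dec (x ∈ F)
          filter∈sublists : ∀ xs → filter ∈F? xs ∈ₗ sublists xs
          filter∈sublists []       = here refl
          filter∈sublists (x ∷ xs) with ∈F? x
          ... | yes _ = ∈ₗ.∈-++⁺ʳ (sublists xs) (∈ₗ.∈-map⁺ (x ∷_) (filter∈sublists xs))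
          ... | no  _ = ∈ₗ.∈-++⁺ˡ (filter∈sublists xs)
          ∈F-resp : ∀ {x y} → x ≈ y → x ∈ F → y ∈ F
          ∈F-resp = ∈ₛ.∈-resp-≈ S
          F⊆filter : ∀ {x} → x ∈ F → x ∈ₛ filter ∈F? Gs
          F⊆filter x∈F = ∈ₛ.∈-filter⁺ S ∈F? ∈F-resp (F⊆G x∈F) x∈F
          filter⊆F : ∀ {x} → x ∈ₛ filter ∈F? Gs → x ∈ F
          filter⊆F x∈ = proj₂ (∈ₛ.∈-filter⁻ S ∈F? ∈F-resp {xs = Gs} x∈)
          covers : g F ∈ₗ values (sublists Gs)
          covers with filter ∈F? Gs | filter∈sublists Gs | F⊆filter | filter⊆F
          ... | []     | _  | F⊆ | _  with () ← F⊆ (here S.refl)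
          ... | x ∷ xs | l∈ | F⊆ | ⊆F =
            ∈ₗ.∈-concatMap⁺ _ (lose l∈ (here (g-cong _ _
              ((λ z∈ → ∈-fromList⁺ (F⊆ z∈)) , λ z∈ → ⊆F (∈-fromList⁻ z∈)))))

-- Construction of α and H

add : Poly₀ → Poly₀ → Poly₀
add []       Q        = Q
add (c ∷ cs) []       = c ∷ cs
add (c ∷ cs) (d ∷ ds) = c ℤ.+ d ∷ add cs ds

eval-add : ∀ P Q x → eval (add P Q) x ≡ eval P x ℤ.+ eval Q x
eval-add []       Q        x = sym (ℤ.+-identityˡ _)
eval-add (c ∷ cs) []       x = sym (ℤ.+-identityʳ _)
eval-add (c ∷ cs) (d ∷ ds) x = trans
  (cong (λ e → x ℤ.* (c ℤ.+ d ℤ.+ e)) (eval-add cs ds x))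
  (distribute x c d (eval cs x) (eval ds x))
  where
  distribute : ∀ x c d a b → x ℤ.* (c ℤ.+ d ℤ.+ (a ℤ.+ b)) ≡ x ℤ.* (c ℤ.+ a) ℤ.+ x ℤ.* (d ℤ.+ b)
  distribute = solve-∀

eval-scale : ∀ k P x → eval (map (k ℤ.*_) P) x ≡ k ℤ.* eval P x
eval-scale k []       x = sym (ℤ.*-zeroʳ k)
eval-scale k (c ∷ cs) x = trans
  (cong (λ e → x ℤ.* (k ℤ.* c ℤ.+ e)) (eval-scale k cs x))
  (factor k x c (eval cs x))
  where
  factor : ∀ k x c a → x ℤ.* (k ℤ.* c ℤ.+ k ℤ.* a) ≡ k ℤ.* (x ℤ.* (c ℤ.+ a))
  factor = solve-∀

-- The increment `P (s + x) - P s` has no constant term in `x`, so a Jₚ-set can handle a polynomial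
-- whose argument has already reached `s`.
translate : ℤ → Poly₀ → Poly₀
translate s []       = []
translate s (c ∷ cs) = add (c ℤ.+ eval cs s ∷ translate s cs) (map (s ℤ.*_) (translate s cs))

eval-translate : ∀ s P x → eval (translate s P) x ≡ eval P (s ℤ.+ x) ℤ.- eval P s
eval-translate s []       x = refl
eval-translate s (c ∷ cs) x = begin
  eval (translate s (c ∷ cs)) x
    ≡⟨ eval-add (c ℤ.+ eval cs s ∷ translate s cs) (map (s ℤ.*_) (translate s cs)) x ⟩
  x ℤ.* (c ℤ.+ eval cs s ℤ.+ eval (translate s cs) x) ℤ.+ eval (map (s ℤ.*_) (translate s cs)) x
    ≡⟨ cong (λ e → x ℤ.* (c ℤ.+ eval cs s ℤ.+ eval (translate s cs) x) ℤ.+ e)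
         (eval-scale s (translate s cs) x) ⟩
  x ℤ.* (c ℤ.+ eval cs s ℤ.+ eval (translate s cs) x) ℤ.+ s ℤ.* eval (translate s cs) x
    ≡⟨ cong (λ e → x ℤ.* (c ℤ.+ eval cs s ℤ.+ e) ℤ.+ s ℤ.* e) (eval-translate s cs x) ⟩
  x ℤ.* (c ℤ.+ eval cs s ℤ.+ (eval cs (s ℤ.+ x) ℤ.- eval cs s)) ℤ.+
    s ℤ.* (eval cs (s ℤ.+ x) ℤ.- eval cs s)
    ≡⟨ collect x s c (eval cs s) (eval cs (s ℤ.+ x)) ⟩
  (s ℤ.+ x) ℤ.* (c ℤ.+ eval cs (s ℤ.+ x)) ℤ.- s ℤ.* (c ℤ.+ eval cs s) ∎
  where
  open ≡-Reasoning
  collect : ∀ x s c a b → x ℤ.* (c ℤ.+ a ℤ.+ (b ℤ.- a)) ℤ.+ s ℤ.* (b ℤ.- a) ≡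
                          (s ℤ.+ x) ℤ.* (c ℤ.+ b) ℤ.- s ℤ.* (c ℤ.+ a)
  collect = solve-∀

infixl 6 _⊹_

-- The left summand is 0 for a coordinate not yet begun.
_⊹_ : ℕ → ℕ⁺ → ℕ⁺
zero  ⊹ y = y
suc x ⊹ y = pos (suc x) +⁺ y

value-⊹ : ∀ x y → value (x ⊹ y) ≡ x ℕ.+ value y
value-⊹ zero    y = refl
value-⊹ (suc x) y = refl

value⊹ : ∀ x y → value x ⊹ y ≡ x +⁺ y
value⊹ x y = value-injective (value-⊹ (value x) y)

-- Left inverse of toℤ, with an arbitrary value at the nonpositive integers.
fromℤ : ℤ → ℕ⁺
fromℤ (+ suc n) = pos (suc n)
fromℤ _         = pos 1

fromℤ-toℤ : ∀ n → fromℤ (toℤ n) ≡ n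
fromℤ-toℤ (pos (suc n)) = refl

-- Partial tuples and their continuations along an idempotent

module Stars (p : βℕ) (idem : Idempotent p) where

  -- The usual D* of an idempotent: unlike D, its translate by any of its own elements is again in
  -- `p`.
  Star : Pred ℕ⁺ 0ℓ → Pred ℕ⁺ 0ℓ
  Star D x = D x × (λ y → D (x +⁺ y)) ∈ᵤ p

  Star-member : ∀ {D} → D ∈ᵤ p → Star D ∈ᵤ p
  Star-member D∈ = meet p D∈ (from (idem _) D∈)

  Star-translate : ∀ {D x} → Star D x → (λ y → Star D (x +⁺ y)) ∈ᵤ p
  Star-translate {D} {x} (_ , D∈) =
    upward p (λ {y} (d , d∈) → d , upward p (λ {z} → subst D (sym (+⁺-assoc x y z))) d∈)
      (Star-member D∈)

module _ (p : βℕ) where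

  -- Extends X j xs: the tuple xs, j coordinates short of full length, has
  -- p-many continuations leading into X.
  Extends : Pred (List ℕ⁺) 0ℓ → ℕ → List ℕ⁺ → Set
  Extends X zero    xs = X xs
  Extends X (suc j) xs = (λ y → Extends X j (xs ∷ʳ y)) ∈ᵤ p

  Extends-suc : ∀ X j {xs} → Extends (λ ys → (λ y → X (ys ∷ʳ y)) ∈ᵤ p) j xs → Extends X (suc j) xs
  Extends-suc X zero    e = e
  Extends-suc X (suc j) e = upward p (Extends-suc X j) e

  -- The tensor power splits off the last coordinate, `Extends` the first; `Extends-suc` reconciles
  -- the two orders.
  ⨂⇒Extends : ∀ k X → (X ∘ Vec.toList) ∈ᵤ ⨂ k (λ _ → p) → Extends X (suc k) []
  ⨂⇒Extends zero    X X∈ = X∈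
  ⨂⇒Extends (suc k) X X∈ = Extends-suc X (suc k) {[]} (⨂⇒Extends k (λ ys → (λ y → X (ys ∷ʳ y)) ∈ᵤ p)
    (upward (⨂ k (λ _ → p)) (λ {v} → upward p (λ {y} → subst X (Vec.toList-∷ʳ y v))) X∈))

module States
  (p : βℕ) (idem : Idempotent p) (X : Pred (List ℕ⁺) 0ℓ) (top : ℕ) (T : FinSet ℙ)
  where

  open Stars p idem
  open Classical (lem p)

  -- (j , xs , x , s): the coordinates xs are complete, a further one is under
  -- construction, and j more will follow; its value so far is x, and the
  -- argument of its polynomial so far is s.
  State : Set
  State = ℕ × List ℕ⁺ × ℕ × ℕ

  -- Because of the star, `x ⊹ y` may either complete the coordinate or be increased further.
  Ext : State → Pred ℕ⁺ 0ℓ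
  Ext (j , xs , x , s) y = Star (λ z → Extends p X j (xs ∷ʳ z)) (x ⊹ y)

  Live : State → Set
  Live st = Ext st ∈ᵤ p

  start : ℕ → List ℕ⁺ → State
  start j xs = j , xs , 0 , 0

  grow : State → ℕ⁺ → ℕ → State
  grow (j , xs , x , s) y s′ = j , xs , value (x ⊹ y) , s ℕ.+ s′

  -- For `j = 0` the tuple is already complete, and `run-blocks` discards the resulting state.
  close : State → ℕ⁺ → State
  close (j , xs , x , s) y = start (ℕ.pred j) (xs ∷ʳ (x ⊹ y))

  live-start : ∀ {j xs} → Extends p X (suc j) xs → Live (start j xs)
  live-start {j} {xs} = Star-member {λ z → Extends p X j (xs ∷ʳ z)}

  live-grow : ∀ st {y} s′ → Ext st y → Live (grow st y s′)
  live-grow (j , xs , x , s) {y} s′ e =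
    upward p (λ {z} → subst (Star D) (sym (value⊹ (x ⊹ y) z))) (Star-translate {D} e)
    where
    D : Pred ℕ⁺ 0ℓ
    D z = Extends p X j (xs ∷ʳ z)

  -- A code holds `α` and `H` at G together with the states that G leads to; larger sets continue
  -- these states without knowing the chain that produced them. Plain lists make choice available
  -- and equality propositional.
  Code : Set
  Code = ℕ⁺ × (ℕ⁺ × List ℕ⁺) × List State

  shiftOf : Code → ℕ⁺
  shiftOf (a , _ , _) = a

  blockOf : Code → List ℕ⁺
  blockOf (_ , (b , bs) , _) = b ∷ bs

  statesOf : Code → List State
  statesOf (_ , _ , sts) = sts

  abstract
    choice-Code : Choice Code
    choice-Code = choice-× choice-ℕ⁺ (choice-× (choice-× choice-ℕ⁺ (list choice-ℕ⁺))
      (list (choice-× choice-ℕ (choice-× (list choice-ℕ⁺) (choice-× choice-ℕ choice-ℕ)))))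
      where
      list : ∀ {Y} → Choice Y → Choice (List Y)
      list = choice-List choice-ℕ

  argument : Code → (ℕ⁺ → ℕ⁺) → ℕ
  argument c f = sum (map (value ∘ f) (blockOf c))

  increment : Poly₀ → ℕ → ℕ → ℤ
  increment P s s′ = eval P (+ (s ℕ.+ s′)) ℤ.- eval P (+ s)

  argOf : State → ℕ
  argOf (_ , _ , _ , s) = s

  Advances : Code → State → ℤ → ℕ → Set
  Advances c st δ s′ =
    Σ[ y ∈ ℕ⁺ ] toℤ y ≡ toℤ (shiftOf c) ℤ.+ δ × Ext st y ×
                grow st y s′ ∈ₗ statesOf c × close st y ∈ₗ statesOf c

  -- A record, so that F and G can be inferred.
  record _⊂_ (F G : FinSet Seq) : Set where
    constructor proper
    field
      proper⁻ : F ⊊ G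

  open _⊂_ public

  Earlier : (G : FinSet Seq) → (∀ {F} → F ⊂ G → Code) → Pred State 0ℓ
  Earlier G IH st = st ≡ start top [] ⊎ Σ[ F ∈ FinSet Seq ] Σ[ lt ∈ F ⊂ G ] st ∈ₗ statesOf (IH {F} lt)

  -- The recorded states may include dead ones, so `advance` asks for liveness at the moment of use;
  -- `live-start` and `live-grow` supply it.
  record Suits (G : FinSet Seq) (IH : ∀ {F} → F ⊂ G → Code) (c : Code) : Set where
    field
      uniq    : UniqueSetoid.Unique Pos (blockOf c)
      later   : ∀ F (lt : F ⊂ G) {i j} → i ∈ₗ blockOf (IH {F} lt) → j ∈ₗ blockOf c → value i < value j
      advance : ∀ st → Earlier G IH st → Live st → ∀ P f → P ∈ T → f ∈ G →
                Advances c st (increment P (argOf st) (argument c f)) (argument c f)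

  ⊂-respʳ : ∀ {F G G′ : FinSet Seq} → Setoid._≈_ (𝒫f Seq) G G′ → F ⊂ G′ → F ⊂ G
  ⊂-respʳ (G⊆G′ , G′⊆G) (proper (F⊆ , ⊈F)) =
    proper ((λ x∈ → G′⊆G (F⊆ x∈)) , λ G⊆F → ⊈F (λ x∈ → G⊆F (G′⊆G x∈)))

  Suits-resp : ∀ {G G′} {IH : ∀ {F} → F ⊂ G → Code} {IH′ : ∀ {F} → F ⊂ G′ → Code} →
               (G≈G′ : Setoid._≈_ (𝒫f Seq) G G′) →
               (∀ {F} (lt : F ⊂ G′) → IH (⊂-respʳ G≈G′ lt) ≡ IH′ lt) →
               ∀ {c} → Suits G IH c → Suits G′ IH′ c
  Suits-resp {G} {G′} {IH} {IH′} G≈G′ e {c} S = record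
    { uniq    = Suits.uniq S
    ; later   = λ F lt i∈ j∈ →
        Suits.later S F (back lt) (subst (λ c → _ ∈ₗ blockOf c) (sym (e lt)) i∈) j∈
    ; advance = λ st E L P f P∈ f∈ → Suits.advance S st (earlier E) L P f P∈ (proj₂ G≈G′ f∈)
    }
    where
    back : ∀ {F} → F ⊂ G′ → F ⊂ G
    back {F} = ⊂-respʳ G≈G′
    earlier : ∀ {st} → Earlier G′ IH′ st → Earlier G IH st
    earlier (inj₁ e₀)            = inj₁ e₀
    earlier (inj₂ (F , lt , s∈)) = inj₂ (F , back lt , subst (λ c → _ ∈ₗ statesOf c) (sym (e lt)) s∈)

module Construction
  (p : βℕ) (idem : Idempotent p) (p∈𝒥ₚ : 𝒥ₚ p)
  (X : Pred (List ℕ⁺) 0ℓ) (top : ℕ) (T : FinSet ℙ)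
  where

  open States p idem X top T

  private
    wf : WellFounded _⊂_
    wf = Subrelation.wellFounded proper⁻ (FiniteSets.⊊-wellFounded Seq)

    choose : ∀ G → WfRec _⊂_ (λ _ → Code) G → Code
    choose G IH = ε choice-Code (Suits G IH)

    choose-ext : ∀ G {IH IH′ : WfRec _⊂_ (λ _ → Code) G} →
                 (∀ {F} (lt : F ⊂ G) → IH lt ≡ IH′ lt) → choose G IH ≡ choose G IH′
    choose-ext G {IH} {IH′} e = ε-cong choice-Code λ c → mk⇔
      (Suits-resp (id , id) e)
      (Suits-resp (id , id) (sym ∘ e))

  code : FinSet Seq → Code
  code = WF.All.wfRec wf 0ℓ (λ _ → Code) choose

  code-unfold : ∀ G → code G ≡ ε choice-Code (Suits G (λ {F} _ → code F))
  code-unfold G = FixPoint.unfold-wfRec wf (λ _ → Code) choose choose-ext {G}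

  -- Equal sets have the same proper subsets, so both codes are chosen from equivalent predicates.
  code-cong : ∀ G G′ → Setoid._≈_ (𝒫f Seq) G G′ → code G ≡ code G′
  code-cong G G′ (G⊆ , ⊆G) = trans (code-unfold G) (trans
    (ε-cong choice-Code λ c → mk⇔
      (Suits-resp {G} {G′} {λ {F} _ → code F} {λ {F} _ → code F} (G⊆ , ⊆G) (λ _ → refl))
      (Suits-resp {G′} {G} {λ {F} _ → code F} {λ {F} _ → code F} (⊆G , G⊆) (λ _ → refl)))
    (sym (code-unfold G′)))

  module Existence (G : FinSet Seq) where

    private
      open FiniteSets using (fromList; ∈-fromList; values-on-subsets)

      Ts : List Poly₀
      Ts = toList (elements T)

      Gs : List (ℕ⁺ → ℕ⁺)
      Gs = toList (elements G)

      codes : Σ[ cs ∈ List Code ] (∀ F → F ⊆ G → code F ∈ₗ cs)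
      codes = values-on-subsets Seq (lem p) code code-cong G

      earlier : List State
      earlier = start top [] ∷ concatMap statesOf (proj₁ codes)

      earlier-complete : ∀ {st} → Earlier G (λ {F} _ → code F) st → st ∈ₗ earlier
      earlier-complete (inj₁ refl)                         = here refl
      earlier-complete (inj₂ (F , proper (F⊆G , _) , st∈)) =
        there (∈ₗ.∈-concatMap⁺ statesOf (lose (proj₂ codes F F⊆G) st∈))

      bound : ℕ
      bound = sum (map value (concatMap blockOf (proj₁ codes)))

      -- Dead states impose no condition, which keeps this finite intersection in `p`.
      B : Pred ℕ⁺ 0ℓ
      B y = All (λ st → Live st → Ext st y) earlier

      B∈p : B ∈ᵤ p
      B∈p = member-All p (All.universal ext∈ earlier)
        where
        ext∈ : ∀ st → (λ y → Live st → Ext st y) ∈ᵤ p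
        ext∈ st with lem p (Live st)
        ... | yes live = upward p (λ e _ → e) live
        ... | no ¬live = member-all p (λ _ live → contradiction live ¬live)

      -- A Jₚ-set gives no control over the position of `β`. The sequences are therefore delayed by
      -- `bound`, and `β` is moved by the same amount to lie beyond all earlier blocks.
      later : ℕ⁺ → ℕ⁺
      later t = pos (bound ℕ.+ value t)
        {{>-nonZero (ℕ.≤-trans (0<value t) (ℕ.m≤n+m (value t) bound))}}

      delay : (ℕ⁺ → ℕ⁺) → ℕ⁺ → ℕ⁺
      delay f = f ∘ later

      translates : State → List Poly₀
      translates st = map (translate (+ argOf st)) Ts

      polynomials : FinSet ℙ
      polynomials = fromList ℙ (lem p) [] (concatMap translates earlier)

      sequences : FinSet Seq
      sequences = fromList Seq (lem p) (delay (List⁺.head (elements G))) (map delay Gs)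

      solution = p∈𝒥ₚ B B∈p polynomials sequences

      a : ℕ⁺
      a = proj₁ solution

      β : FinSet Pos
      β = proj₁ (proj₂ solution)

      block : ℕ⁺ × List ℕ⁺
      block = later (List⁺.head (elements β)) , map later (List⁺.tail (elements β))

      sumOver : (ℕ⁺ → ℕ⁺) → ℕ
      sumOver = argument (a , block , [])

      sumOver-delay : ∀ f → ∑ β (value ∘ delay f) ≡ sumOver f
      sumOver-delay f = cong sum (List.map-∘ (toList (elements β)))

      -- Reading the summand off its integer value makes the list of successors independent of
      -- membership proofs; `y≡c` identifies it with the element of `B`.
      continuation : State → Poly₀ → (ℕ⁺ → ℕ⁺) → ℕ⁺
      continuation st P f = fromℤ (toℤ a ℤ.+ increment P (argOf st) (sumOver f))

      successors : State → Poly₀ → (ℕ⁺ → ℕ⁺) → List State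
      successors st P f =
        grow st (continuation st P f) (sumOver f) ∷ close st (continuation st P f) ∷ []

      states : List State
      states = concatMap (λ st → concatMap (λ P → concatMap (successors st P) Gs) Ts) earlier

      c : Code
      c = a , block , states

      successors⊆states : ∀ {st P f st′} → st ∈ₗ earlier → P ∈ₗ Ts → f ∈ₗ Gs →
                          st′ ∈ₗ successors st P f → st′ ∈ₗ states
      successors⊆states {st} {P} st∈ P∈ f∈ st′∈ =
        ∈ₗ.∈-concatMap⁺ (λ st → concatMap (λ P → concatMap (successors st P) Gs) Ts) (lose st∈
          (∈ₗ.∈-concatMap⁺ (λ P → concatMap (successors st P) Gs) (lose P∈
            (∈ₗ.∈-concatMap⁺ (successors st P) (lose f∈ st′∈)))))

      advances : ∀ st P f → st ∈ₗ earlier → Live st → P ∈ₗ Ts → f ∈ₗ Gs →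
                 Advances c st (increment P (argOf st) (sumOver f)) (sumOver f)
      advances st P f st∈ live P∈ f∈ =
        y , y≡ , All.lookup By st∈ live ,
        successors⊆states st∈ P∈ f∈ (here (cong (λ y → grow st y (sumOver f)) y≡c)) ,
        successors⊆states st∈ P∈ f∈ (there (here (cong (close st) y≡c)))
        where
        open ≡-Reasoning
        Q : Poly₀
        Q = translate (+ argOf st) P
        Q∈ : Q ∈ polynomials
        Q∈ = ∈-fromList ℙ (lem p) [] (concatMap translates earlier)
               (∈ₗ.∈-concatMap⁺ translates (lose st∈ (∈ₗ.∈-map⁺ (translate (+ argOf st)) P∈)))
        f∈′ : delay f ∈ sequences
        f∈′ = ∈-fromList Seq (lem p) (delay (List⁺.head (elements G))) (map delay Gs)
                (∈ₗ.∈-map⁺ delay f∈)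
        hit = proj₂ (proj₂ solution) Q (delay f) Q∈ f∈′
        y : ℕ⁺
        y = proj₁ hit
        By : B y
        By = proj₂ (proj₂ hit)
        y≡ : toℤ y ≡ toℤ a ℤ.+ increment P (argOf st) (sumOver f)
        y≡ = begin
          toℤ y
            ≡⟨ proj₁ (proj₂ hit) ⟩
          toℤ a ℤ.+ eval Q (+ ∑ β (value ∘ delay f))
            ≡⟨ cong (λ s → toℤ a ℤ.+ eval Q (+ s)) (sumOver-delay f) ⟩
          toℤ a ℤ.+ eval Q (+ sumOver f)
            ≡⟨ cong (λ e → toℤ a ℤ.+ e) (eval-translate (+ argOf st) P (+ sumOver f)) ⟩
          toℤ a ℤ.+ increment P (argOf st) (sumOver f) ∎
        y≡c : y ≡ continuation st P f
        y≡c = trans (sym (fromℤ-toℤ y)) (cong fromℤ y≡)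

    suitable : Σ[ c ∈ Code ] Suits G (λ {F} _ → code F) c
    suitable = c , record
      { uniq    = Unique.map⁺ Pos Pos {later}
          (λ {t} {u} e → value-injective (ℕ.+-cancelˡ-≡ bound (value t) (value u) (cong value e)))
          (FinSet.unique β)
      ; later   = λ F (proper (F⊆G , _)) {i} {j} i∈ j∈ → beyond {i} {j}
          (∈⇒≤sum (∈ₗ.∈-map⁺ value (∈ₗ.∈-concatMap⁺ blockOf (lose (proj₂ codes F F⊆G) i∈)))) j∈
      ; advance = λ st st∈ live P f P∈ f∈ →
          let (P′ , P′∈ , P≈P′) = find P∈
              (f′ , f′∈ , f≈f′) = find f∈
              s≡ = cong sum (List.map-cong (λ t → cong value (sym (f≈f′ t))) (blockOf c))
          in subst₂ (Advances c st)
               (trans (cong (increment P′ (argOf st)) s≡)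
                      (sym (cong₂ ℤ._-_ (eval-cong P P′ P≈P′ _) (eval-cong P P′ P≈P′ _))))
               s≡
               (advances st P′ f′ (earlier-complete st∈) live P′∈ f′∈)
      }
      where
      beyond : ∀ {i j} → value i ≤ bound → j ∈ₗ blockOf c → value i < value j
      beyond i≤ j∈ with ∈ₗ.∈-map⁻ later {xs = toList (elements β)} j∈
      ... | t , _ , refl = ℕ.≤-<-trans i≤ (ℕ.m<m+n bound (0<value t))

  code-suits : ∀ G → Suits G (λ {F} _ → code F) (code G)
  code-suits G = subst (Suits G (λ {F} _ → code F)) (sym (code-unfold G))
    (ε-sound choice-Code (Existence.suitable G))

-- Evaluation along a chain

els : FinSet Pos → List ℕ⁺
els β = toList (elements β)

max-upper : ∀ β {i} → i ∈ₗ els β → value i ≤ max β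
max-upper β = go _ _
  where
  go : ∀ x xs {i} → i ∈ₗ x ∷ xs → value i ≤ foldr₁ _⊔_ (List⁺.map value (x ∷ xs))
  go x []       (here refl) = ℕ.≤-refl
  go x (y ∷ ys) (here refl) = ℕ.m≤m⊔n (value x) _
  go x (y ∷ ys) (there i∈)  = ℕ.≤-trans (go y ys i∈) (ℕ.m≤n⊔m (value x) _)

min-lower : ∀ β {i} → i ∈ₗ els β → min β ≤ value i
min-lower β = go _ _
  where
  go : ∀ x xs {i} → i ∈ₗ x ∷ xs → foldr₁ _⊓_ (List⁺.map value (x ∷ xs)) ≤ value i
  go x []       (here refl) = ℕ.≤-refl
  go x (y ∷ ys) (here refl) = ℕ.m⊓n≤m (value x) _
  go x (y ∷ ys) (there i∈)  = ℕ.≤-trans (ℕ.m⊓n≤n (value x) _) (go y ys i∈)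

foldr₁-selects : ∀ (_∙_ : ℕ → ℕ → ℕ) → (∀ m n → m ∙ n ≡ m ⊎ m ∙ n ≡ n) →
                 ∀ x xs → Σ[ i ∈ ℕ⁺ ] i ∈ₗ x ∷ xs × foldr₁ _∙_ (List⁺.map value (x ∷ xs)) ≡ value i
foldr₁-selects _∙_ sel x []       = x , here refl , refl
foldr₁-selects _∙_ sel x (y ∷ ys)
  with sel (value x) (foldr₁ _∙_ (List⁺.map value (y ∷ ys)))
... | inj₁ e = x , here refl , e
... | inj₂ e = let (i , i∈ , e′) = foldr₁-selects _∙_ sel y ys in i , there i∈ , trans e e′

≺-intro : ∀ β γ → (∀ {i j} → i ∈ₗ els β → j ∈ₗ els γ → value i < value j) → β ≺ γ
≺-intro β γ lt =
  let (i , i∈ , max≡) = foldr₁-selects _⊔_ ℕ.⊔-sel _ _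
      (j , j∈ , min≡) = foldr₁-selects _⊓_ ℕ.⊓-sel _ _
  in subst₂ ℕ._<_ (sym max≡) (sym min≡) (lt i∈ j∈)

min≤max : ∀ β → min β ≤ max β
min≤max β = ℕ.≤-trans (min-lower β (here refl)) (max-upper β (here refl))

module SortPos = Sort (On.decTotalOrder ℕ.≤-decTotalOrder value)

-- The chain has to be traversed in increasing order, while a block may be listed in any order.
sorted : FinSet Pos → List ℕ⁺
sorted β = SortPos.sort (els β)

sorted-↭ : ∀ β → sorted β ↭ els β
sorted-↭ β = SortPos.sort-↭ (els β)

sorted-< : ∀ β → AllPairs (λ i j → value i < value j) (sorted β)
sorted-< β = AllPairs.zipWith (λ (le , ≢) → ℕ.≤∧≢⇒< le (≢ ∘ value-injective))
  ( Linked.Linked⇒AllPairs ℕ.≤-trans (SortPos.sort-↗ (els β))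
  , ↭ₛ.Unique-resp-↭ Pos (↭⇒↭ₛ (↭-sym (sorted-↭ β))) (FinSet.unique β) )

∑-sorted : ∀ β g → ∑ β g ≡ sum (map g (sorted β))
∑-sorted β g = sum-↭ (↭.map⁺ g (↭-sym (sorted-↭ β)))

module _ (E : ℕ → ℤ) where

  first-increment : ∀ x a r s {y₀ z} → y₀ ≡ + a ℤ.+ (E (r ℕ.+ s) ℤ.- E r) → z ≡ + x ℤ.+ y₀ →
                    z ≡ + (x ℕ.+ (a ℕ.+ 0)) ℤ.+ (E (r ℕ.+ (s ℕ.+ 0)) ℤ.- E r)
  first-increment x a r s refl refl rewrite ℕ.+-identityʳ a | ℕ.+-identityʳ s =
    sym (ℤ.+-assoc (+ x) (+ a) (E (r ℕ.+ s) ℤ.- E r))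

  -- The increments telescope through the intermediate argument `r + s`.
  next-increment : ∀ x a A r s S {y₀ z y} → y₀ ≡ + a ℤ.+ (E (r ℕ.+ s) ℤ.- E r) → z ≡ + x ℤ.+ y₀ →
                   y ≡ z ℤ.+ + A ℤ.+ (E (r ℕ.+ s ℕ.+ S) ℤ.- E (r ℕ.+ s)) →
                   y ≡ + (x ℕ.+ (a ℕ.+ A)) ℤ.+ (E (r ℕ.+ (s ℕ.+ S)) ℤ.- E r)
  next-increment x a A r s S refl refl refl rewrite ℕ.+-assoc r s S =
    telescope (+ x) (+ a) (+ A) (E r) (E (r ℕ.+ s)) (E (r ℕ.+ (s ℕ.+ S)))
    where
    telescope : ∀ x a b e f g → x ℤ.+ (a ℤ.+ (f ℤ.- e)) ℤ.+ b ℤ.+ (g ℤ.- f) ≡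
                                x ℤ.+ (a ℤ.+ b) ℤ.+ (g ℤ.- e)
    telescope = solve-∀

module _ (p : βℕ) (idem : Idempotent p) (X : Pred (List ℕ⁺) 0ℓ) (top : ℕ) (T : FinSet ℙ) where

  open States p idem X top T

  -- The choice of codes is a parameter, so that the recursion defining it stays opaque.
  module Assembly
    (code : FinSet Seq → Code)
    (code-cong : ∀ G G′ → Setoid._≈_ (𝒫f Seq) G G′ → code G ≡ code G′)
    (code-suits : ∀ G → Suits G (λ {F} _ → code F) (code G))
    where

    α : Func (𝒫f Seq) Pos
    α = record { to = shiftOf ∘ code ; cong = λ {G} {G′} G≈G′ → cong shiftOf (code-cong G G′ G≈G′) }

    H : Func (𝒫f Seq) (𝒫f Pos)
    H = record
      { to   = block
      ; cong = λ {G} {G′} G≈G′ → same {block G} {block G′} (cong blockOf (code-cong G G′ G≈G′))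
      }
      where
      block : FinSet Seq → FinSet Pos
      block G = record
        { elements = proj₁ (proj₁ (proj₂ (code G))) ∷ proj₂ (proj₁ (proj₂ (code G)))
        ; unique   = Suits.uniq (code-suits G)
        }
      same : ∀ {β γ : FinSet Pos} → els β ≡ els γ → Setoid._≈_ (𝒫f Pos) β γ
      same e = (λ {i} → subst (i ∈ₗ_) e) , λ {i} → subst (i ∈ₗ_) (sym e)

    H-increasing : ∀ G K′ → G ⊊ K′ → (H ⟨$⟩ G) ≺ (H ⟨$⟩ K′)
    H-increasing G K′ lt =
      ≺-intro (H ⟨$⟩ G) (H ⟨$⟩ K′) (Suits.later (code-suits K′) G (proper lt))

    module Chain
      (n : ℕ) (G : ℕ⁺ → FinSet Seq)
      (chain : ∀ i j → value i < value j → value j ≤ n → G i ⊊ G j)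
      (f : ℕ⁺ → ℕ⁺ → ℕ⁺) (f∈G : ∀ i → value i ≤ n → f i ∈ G i)
      where

      a s : ℕ⁺ → ℕ
      a i = value (α ⟨$⟩ G i)
      s i = ∑ (H ⟨$⟩ G i) (λ t → value (f i t))

      Reached : ℕ → State → Set
      Reached c st = st ≡ start top [] ⊎ Σ[ i ∈ ℕ⁺ ] value i ≤ c × st ∈ₗ statesOf (code (G i))

      step : ∀ P {c i st} → c < value i → value i ≤ n → Reached c st → Live st → P ∈ T →
             Advances (code (G i)) st (increment P (argOf st) (s i)) (s i)
      step P {c} {i} {st} c<i i≤n reached live P∈ =
        Suits.advance (code-suits (G i)) st (earlier reached) live P (f i) P∈ (f∈G i i≤n)
        where
        earlier : Reached c st → Earlier (G i) (λ {F} _ → code F) st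
        earlier (inj₁ e)               = inj₁ e
        earlier (inj₂ (i′ , i′≤c , s∈)) =
          inj₂ (G i′ , proper (chain i′ i (ℕ.≤-<-trans i′≤c c<i) i≤n) , s∈)

      -- One coordinate is completed by running through an increasing list of indices.
      run : ∀ P → P ∈ T → ∀ {c} i is → All (λ i → c < value i) (i ∷ is) →
            AllPairs (λ i j → value i < value j) (i ∷ is) → All (λ i → value i ≤ n) (i ∷ is) →
            ∀ j xs x r → Reached c (j , xs , x , r) → Live (j , xs , x , r) →
            Σ[ y ∈ ℕ⁺ ]
              toℤ y ≡ + (x ℕ.+ sum (map a (i ∷ is))) ℤ.+ increment P r (sum (map s (i ∷ is))) ×
              Extends p X j (xs ∷ʳ y) ×
              (∀ b → All (λ i → value i ≤ b) (i ∷ is) → Reached b (start (ℕ.pred j) (xs ∷ʳ y)))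
      -- The last index of a block takes the closed successor, every other index the grown one.
      run P P∈ i [] (c<i ∷ []) _ (i≤n ∷ []) j xs x r reached live =
        let (y , y≡ , ext , _ , closed) = step P c<i i≤n reached live P∈
        in x ⊹ y , first-increment (λ v → eval P (+ v)) x (a i) r (s i) y≡ (cong +_ (value-⊹ x y)) ,
           proj₁ ext , λ { b (i≤b ∷ []) → inj₂ (i , i≤b , closed) }
      run P P∈ i (i′ ∷ is) (c<i ∷ _) (i<is ∷ incr) (i≤n ∷ is≤n) j xs x r reached live =
        let (y₀ , y₀≡ , ext , grown , _) = step P c<i i≤n reached live P∈
            (y , y≡ , ok , closed) = run P P∈ i′ is i<is incr is≤n j xs (value (x ⊹ y₀)) (r ℕ.+ s i)
                                       (inj₂ (i , ℕ.≤-refl , grown))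
                                       (live-grow (j , xs , x , r) (s i) ext)
        in y , next-increment (λ v → eval P (+ v)) x (a i) (sum (map a (i′ ∷ is))) r (s i)
                 (sum (map s (i′ ∷ is))) y₀≡ (cong +_ (value-⊹ x y₀)) y≡ ,
           ok , λ { b (_ ∷ is≤b) → closed b is≤b }

      coordinate : FinSet Pos → Poly₀ → ℤ
      coordinate β P = + ∑ β a ℤ.+ eval P (+ ∑ β s)

      eval-0 : ∀ P → eval P 0ℤ ≡ 0ℤ
      eval-0 []       = refl
      eval-0 (c ∷ cs) = ℤ.*-zeroˡ (c ℤ.+ eval cs 0ℤ)

      run-block : ∀ P → P ∈ T → ∀ {c} β → (∀ {i} → i ∈ₗ els β → c < value i) → max β ≤ n →
                  ∀ j xs → Reached c (start j xs) → Live (start j xs) →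
                  Σ[ y ∈ ℕ⁺ ] toℤ y ≡ coordinate β P × Extends p X j (xs ∷ʳ y) ×
                              Reached (max β) (start (ℕ.pred j) (xs ∷ʳ y))
      run-block P P∈ {c} β c<β β≤n j xs reached live
        with sorted β | sorted-↭ β | sorted-< β | ∑-sorted β
      ... | []     | perm | _    | _   with () ← ↭.∈-resp-↭ (↭-sym perm) (here refl)
      ... | i ∷ is | perm | incr | sums =
        let (y , y≡ , ok , closed) =
              run P P∈ i is (All.tabulate (c<β ∘ ↭.∈-resp-↭ perm)) incr
                (All.tabulate λ i∈ → ℕ.≤-trans (max-upper β (↭.∈-resp-↭ perm i∈)) β≤n)
                j xs 0 0 reached live
        in y ,
           trans y≡ (cong₂ ℤ._+_ (cong +_ (sym (sums a)))
             -- A coordinate starts with argument 0, where `P` vanishes, so the total increment is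
             -- the value of `P`.
             (trans (cong (λ e → eval P _ ℤ.- e) (eval-0 P))
               (trans (ℤ.+-identityʳ _) (cong (λ v → eval P (+ v)) (sym (sums s)))))) ,
           ok , closed (max β) (All.tabulate (max-upper β ∘ ↭.∈-resp-↭ perm))

      run-blocks : ∀ j {c xs} (β : Fin (suc j) → FinSet Pos) → (∀ k l → k Fin.< l → β k ≺ β l) →
                   (∀ {i} → i ∈ₗ els (β Fin.zero) → c < value i) → (∀ k → max (β k) ≤ n) →
                   (P : Fin (suc j) → Poly₀) → (∀ k → P k ∈ T) →
                   Reached c (start j xs) → Extends p X (suc j) xs →
                   Σ[ ys ∈ List ℕ⁺ ] map toℤ ys ≡ Data.List.tabulate (λ k → coordinate (β k) (P k)) ×
                                     X (xs ++ ys)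
      run-blocks j {c} {xs} β incr c<β β≤n P P∈ reached good
        with run-block (P Fin.zero) (P∈ Fin.zero) (β Fin.zero) c<β (β≤n Fin.zero) j xs reached
               (live-start {j} {xs} good)
      run-blocks zero    β incr c<β β≤n P P∈ reached good | y , y≡ , ok , _ =
        y ∷ [] , cong (_∷ []) y≡ , ok
      run-blocks (suc j) {c} {xs} β incr c<β β≤n P P∈ reached good | y , y≡ , ok , closed =
        let (ys , ys≡ , Xys) = run-blocks j {max (β Fin.zero)} {xs ∷ʳ y} (β ∘ Fin.suc)
                                 (λ k l k<l → incr (Fin.suc k) (Fin.suc l) (s≤s k<l))
                                 (λ i∈ → ℕ.<-≤-trans (incr Fin.zero (Fin.suc Fin.zero) (s≤s z≤n))
                                                     (min-lower (β (Fin.suc Fin.zero)) i∈))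
                                 (β≤n ∘ Fin.suc) (P ∘ Fin.suc) (P∈ ∘ Fin.suc) closed ok
        in y ∷ ys , cong₂ _∷_ y≡ ys≡ , subst X (List.++-assoc xs (y ∷ []) ys) Xys

toList-tabulate : ∀ {A : Set} {n} (f : Fin n → A) → Vec.toList (tabulate f) ≡ Data.List.tabulate f
toList-tabulate {n = zero}  f = refl
toList-tabulate {n = suc n} f = cong (f Fin.zero ∷_) (toList-tabulate (f ∘ Fin.suc))

max≤max-last : ∀ {k} (β : Fin (suc k) → FinSet Pos) → (∀ i j → i Fin.< j → β i ≺ β j) →
               ∀ i → max (β i) ≤ max (last β)
max≤max-last {k} β incr i with Fin.<-cmp i (fromℕ k)
... | tri< i<k _ _  = ℕ.≤-trans (ℕ.<⇒≤ (incr i (fromℕ k) i<k)) (min≤max (last β))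
... | tri≈ _ refl _ = ℕ.≤-refl
... | tri> _ _ k<i  = contradiction (Fin.≤fromℕ i) (ℕ.<⇒≱ k<i)

idempotent∈𝒥ₚ : ∀ {p} → MinimalIdempotent p ⊎ (𝒥ₚ p × Idempotent p) → 𝒥ₚ p × Idempotent p
idempotent∈𝒥ₚ {p} (inj₁ minimal)  = MinimalIdempotents.minimalIdempotent∈𝒥ₚ p minimal , proj₁ minimal
idempotent∈𝒥ₚ     (inj₂ p∈𝒥ₚ)     = p∈𝒥ₚ

theorem1p27 : (m-1 : ℕ) → let m = suc m-1 in
    (p : βℕ) → MinimalIdempotent p ⊎ (𝒥ₚ p × Idempotent p) →
    (A : Pred (Vec ℕ⁺ m) 0ℓ) → A ∈ᵤ ⨂ m-1 (λ _ → p) →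
    (T : FinSet ℙ) →
    Σ[ α ∈ Func (𝒫f Seq) Pos ]
    Σ[ H ∈ Func (𝒫f Seq) (𝒫f Pos) ]
    ((G K′ : FinSet Seq) → G ⊊ K′ → (H ⟨$⟩ G) ≺ (H ⟨$⟩ K′))
    ×
    ((n : ℕ) → m ≤ n →
    (G : ℕ⁺ → FinSet Seq) →
    (∀ i j → value i < value j → value j ≤ n → G i ⊊ G j) →
    (β : Fin m → FinSet Pos) →
    (∀ i j → i Fin.< j → β i ≺ β j) →
    max (last β) ≤ n →
    (f : ℕ⁺ → ℕ⁺ → ℕ⁺) →
    (∀ i → value i ≤ n → f i ∈ G i) →
    (P : Fin m → Poly₀) →
    (∀ j → P j ∈ T) →
    tabulate (λ j →
    + ∑ (β j) (λ i → value (α ⟨$⟩ G i))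
    ℤ.+ eval (P j)
    (+ ∑ (β j) (λ i → ∑ (H ⟨$⟩ G i) (λ t → value (f i t)))))
    ∈ℤⁿ A)
theorem1p27 m-1 p p-ideal A A∈ T =
  α , H , H-increasing , λ n _ G chain β incr β≤n f f∈G P P∈ →
    let open Chain n G chain f f∈G
        (ys , ys≡ , (v , v≡ys , Av)) =
          run-blocks m-1 {0} {[]} β incr (λ {i} _ → 0<value i)
            (λ k → ℕ.≤-trans (max≤max-last β incr k) β≤n) P P∈ (inj₁ refl)
            (⨂⇒Extends p m-1 X (Ultrafilter.upward (⨂ m-1 (λ _ → p)) (λ {v} Av → v , refl , Av) A∈))
    in v , trans (sym (Vec.cast-is-id refl _)) (Vec.toList-injective refl _ _
             (trans (Vec.toList-map toℤ v) (trans (cong (map toℤ) v≡ys)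
               (trans ys≡ (sym (toList-tabulate (λ k → coordinate (β k) (P k)))))))) , Av
  where
  -- Partial tuples vary in length, so `A` is carried over to lists.
  X : Pred (List ℕ⁺) 0ℓ
  X xs = Σ[ v ∈ Vec ℕ⁺ (suc m-1) ] Vec.toList v ≡ xs × A v
  p∈𝒥ₚ : 𝒥ₚ p
  p∈𝒥ₚ = proj₁ (idempotent∈𝒥ₚ p-ideal)
  idem : Idempotent p
  idem = proj₂ (idempotent∈𝒥ₚ p-ideal)
  module C = Construction p idem p∈𝒥ₚ X m-1 T
  open Assembly p idem X m-1 T C.code C.code-cong C.code-suits
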